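{- Let $N\in\mathbb{N}$ and let $w\in\mathcal{A}_N^{\mathbb{N}}$ be a non-periodic uniformly recurrent infinite word. If there is a constant $C$, independent of $n$, such that the number of connected components of $G_n$ is at most $C$ for every $n\in\mathbb{N}$, then $(w,\mathbf{x}_p)\notin\mathbf{LMad}$ for every $\mathbf{x}_p\in\mathbf{P}^1(\mathbb{Q}_p)$.
   Context: A word is uniformly recurrent if every finite factor occurs infinitely often and the gaps between consecutive occurrences of each factor are bounded. For $n\in\mathbb{N}$, $G_n=(S_n,T_n,E_n)$ is the bipartite graph where $S_n$ and $T_n$ are two (disjoint) copies of the set of distinct factors of $w$ of length $n$, and $s\in S_n$, $t\in T_n$ are joined by an edge iff the concatenation $st$ is a factor of $w$. Fix a prime $p$; $|\cdot|_p$ is the $p$-adic absolute value. $\mathcal{A}_N=\{1,\ldots,N\}$. For $a\in\mathbb{N}$, $A_a=\begin{pmatrix}0&1\\1&a\end{pmatrix}$. For an infinite word $w=a_1a_2\ldots$, $\mathrm{T}w=a_2a_3\ldots$; points of $\mathbf{P}^1(\mathbb{Q}_p)$ are column vectors $(q_1,q_2)^T$ in homogeneous coordinates and $\mathrm{T}(w,\mathbf{q})=(\mathrm{T}w,A_{a_1}\mathbf{q})$. For $\epsilon>0$, $(q_1,q_2)\in\mathbf{PBad}_\epsilon$ if for all $(a,b)\in\mathbb{Z}^2\setminus\{(0,0)\}$, $\frac{|aq_1+bq_2|_p}{\max\{|q_1|_p,|q_2|_p\}}\ge\frac{\epsilon}{\max\{a^2,b^2\}}$. $\mathbf{LMad}_\epsilon$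 is the set of pairs $(w,\mathbf{x}_p)$ with $\mathrm{T}^n(w,\mathbf{x}_p)\in\mathcal{A}_{N'}^{\mathbb{N}}\times\mathbf{PBad}_\epsilon$ for all integers $n\ge0$, where $N'=\lfloor\epsilon^{ -1}\rfloor+1$; $\mathbf{LMad}=\bigcup_{\epsilon>0}\mathbf{LMad}_\epsilon$. -}

module Defs where

open import Data.Nat using (ℕ; zero; suc; _+_; _*_; _≤_; _<_; _^_; _/_; _⊔_)
open import Data.Nat.Divisibility using () renaming (_∣_ to _∣ℕ_)
open import Data.Integer using (ℤ; +_; ∣_∣) renaming (_+_ to _+ℤ_; _*_ to _*ℤ_)
open import Data.Integer.Divisibility using () renaming (_∣_ to _∣ℤ_)
open import Data.Fin using (Fin; toℕ)
open import Data.Vec using (Vec; lookup; _++_)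
open import Data.List using (List; length)
open import Data.List.Relation.Unary.Any using (Any)
open import Data.Product using (Σ; ∃; _×_; _,_)
open import Relation.Binary.PropositionalEquality using (_≡_)
open import Relation.Nullary using (¬_)
open import Relation.Binary.Construct.Closure.Equivalence using (EqClosure)

-- Infinite words over ℕ (letters a_1 a_2 ... are w 0, w 1, ...)

Word : Set
Word = ℕ → ℕ

InAlphabet : ℕ → Word → Set
InAlphabet N w = ∀ i → 1 ≤ w i × w i ≤ N

OccursAt : {n : ℕ} → Word → Vec ℕ n → ℕ → Set
OccursAt {n} w u i = ∀ (j : Fin n) → w (i + toℕ j) ≡ lookup u j

IsFactor : {n : ℕ} → Word → Vec ℕ n → Set
IsFactor w u = ∃ λ i → OccursAt w u i

UniformlyRecurrent : Word → Set
UniformlyRecurrent w =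
  ∀ (n : ℕ) (u : Vec ℕ n) → IsFactor w u →
    ∃ λ B → ∀ i → ∃ λ j → i ≤ j × j ≤ i + B × OccursAt w u j

Periodic : Word → Set
Periodic w = ∃ λ q → 0 < q × (∀ i → w (q + i) ≡ w i)

data Side : Set where
  S T : Side

Vertex : ℕ → Set
Vertex n = Side × Vec ℕ n

data Edge (w : Word) (n : ℕ) : Vertex n → Vertex n → Set where
  edge : ∀ {s t : Vec ℕ n} → IsFactor w (s ++ t) → Edge w n (S , s) (T , t)

Connected : (w : Word) (n : ℕ) → Vertex n → Vertex n → Set
Connected w n = EqClosure (Edge w n)

ComponentsAtMost : Word → ℕ → ℕ → Set
ComponentsAtMost w n C =
  ∃ λ (reps : List (Vertex n)) → length reps ≤ C ×
    (∀ (side : Side) (u : Vec ℕ n) → IsFactor w u →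
       Any (λ r → Connected w n (side , u) r) reps)

record Zp (p : ℕ) : Set where
  field
    res    : ℕ → ℕ
    bound  : ∀ k → res k < p ^ k
    compat : ∀ k → ∃ λ d → res (suc k) ≡ res k + d * p ^ k
open Zp public

-- a point of P^1(Q_p) given by homogeneous coordinates (x1, x2) ∈ Z_p^2,
-- not both zero (every point of P^1(Q_p) has such a representative)
NonZeroPt : {p : ℕ} → Zp p → Zp p → Set
NonZeroPt {p} x1 x2 = ∃ λ k → ¬ ((p ^ k ∣ℕ res x1 k) × (p ^ k ∣ℕ res x2 k))

ValGe : {p : ℕ} → Zp p → Zp p → ℤ → ℤ → ℕ → Set
ValGe {p} x1 x2 c1 c2 k =
  (+ (p ^ k)) ∣ℤ ((c1 *ℤ (+ res x1 k)) +ℤ (c2 *ℤ (+ res x2 k)))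

record Mat : Set where
  constructor mat
  field
    m11 m12 m21 m22 : ℕ
open Mat public

-- A_a * M  where A_a = [[0,1],[1,a]]
A· : ℕ → Mat → Mat
A· a (mat b11 b12 b21 b22) = mat b21 b22 (b11 + a * b21) (b12 + a * b22)

-- Mpow w n = A_{a_n} ⋯ A_{a_1}, so that T^n (w , x) = (T^n w , Mpow w n · x)
Mpow : Word → ℕ → Mat
Mpow w zero    = mat 1 0 0 1
Mpow w (suc n) = A· (w n) (Mpow w n)

shift : ℕ → Word → Word
shift n w i = w (n + i)

-- PBad_ε for the point y = M·x, with ε = e / d  (e , d ≥ 1).
-- With y = (y1,y2), y_i = m_i1 x1 + m_i2 x2, and z = a y1 + b y2
--   = (a m11 + b m21) x1 + (a m12 + b m22) x2,
-- the condition |z|_p / max(|y1|_p,|y2|_p) ≥ ε / max(a²,b²) is equivalent to: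
-- whenever v(z) ≥ k and v(y) := min(v(y1),v(y2)) ≤ l,
--   e * p^k ≤ d * max(a²,b²) * p^l.

PBadAt : (p : ℕ) → ℕ → ℕ → Mat → Zp p → Zp p → Set
PBadAt p e d M x1 x2 =
  ∀ (a b : ℤ) → ¬ (a ≡ + 0 × b ≡ + 0) → ∀ (k l : ℕ) →
    ValGe x1 x2 ((a *ℤ + m11 M) +ℤ (b *ℤ + m21 M))
                ((a *ℤ + m12 M) +ℤ (b *ℤ + m22 M)) k →
    ¬ (ValGe x1 x2 (+ m11 M) (+ m12 M) (suc l) ×
       ValGe x1 x2 (+ m21 M) (+ m22 M) (suc l)) →
    e * p ^ k ≤ d * ((∣ a ∣ ⊔ ∣ b ∣) ^ 2) * p ^ l

-- LMad_ε with ε = suc i / suc j; N' = ⌊1/ε⌋ + 1 = ⌊suc j / suc i⌋ + 1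
LMadε : (p : ℕ) → ℕ → ℕ → Word → Zp p → Zp p → Set
LMadε p i j w x1 x2 =
  ∀ (n : ℕ) →
    InAlphabet (suc (suc j / suc i)) (shift n w) ×
    PBadAt p (suc i) (suc j) (Mpow w n) x1 x2

-- LMad = ⋃_{ε > 0} LMad_ε ; since LMad_ε grows as ε decreases, it suffices
-- to take ε ranging over positive rationals.
LMad : (p : ℕ) → Word → Zp p → Zp p → Set
LMad p w x1 x2 = ∃ λ i → ∃ λ j → LMadε p i j w x1 x2

{-# OPTIONS --safe #-}
module Submission where

-- Let y_i ∈ P¹(ℤ_p) be the image of x under M_i = A_{a_i} ⋯ A_{a_1}.  Fix k and attach to a factor u of w
-- the fibre {M_i mod p^k : u occurs at i}.  A factor whose fibre has the least possible size occurs in every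
-- long factor, so all long factors have fibres of that size, and a fibre does not change when the factor is
-- extended.  Hence (a) fibres are constant on the connected components of G_n for large n, and (b) if a long
-- factor occurs at i and at j, then its fibre is stable under g = M_j M_i⁻¹.
--
-- If moreover g ≡ 1 mod p², a Hensel argument shows that the orbit of y_i under g fills the whole ball of radius
-- |det(y_i, g y_i)|_p around y_i, up to precision p^k.  As all points of the orbit come from positions of w,
-- they satisfy the PBad inequality, which the rational point of least height in the ball violates unless the
-- ball is small.  So y_i ≡ y_j mod p^r, where r → ∞ as k → ∞.
--
-- By (a), the y_i take at most C · p⁸ values mod p^r for every r, hence finitely many values, and one of them
-- is taken at infinitely many positions.  The transition matrices between these positions fix a common
-- irrational point, hence commute; the matrices A_a generate a free monoid, so the corresponding words commute
-- and w is eventually periodic.  Being uniformly recurrent, it is then periodic.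
--
-- The conclusion is a negation, so the classical steps are carried out under double negation.

open import Defs
open import Data.Fin as Fin using (Fin; combine; fromℕ<; inject≤; toℕ)
open import Data.Fin.Properties as Finₚ using (any?; combine-injective; fromℕ<-cong; fromℕ<-injective; inject≤-injective; pigeonhole; toℕ-fromℕ<; toℕ-↑ʳ; toℕ-↑ˡ; toℕ<n)
open import Data.Integer as ℤ using (ℤ; +_; -[1+_]; ∣_∣; _+_; _*_; _-_; -_; 0ℤ; 1ℤ)
open import Data.Integer.DivMod using (_%ℕ_; _/ℕ_; n%ℕd<d; a≡a%ℕn+[a/ℕn]*n)
open import Data.Integer.Divisibility.Signed
open import Data.Integer.Properties using (abs-*; *-assoc; *-comm; *-identityʳ; +-injective; i*j≡0⇒i≡0∨j≡0; i-j≡0⇒i≡j; m-n≡m⊖n; pos-+; pos-*; ∣-i∣≡∣i∣; ⊖-≥)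
open import Data.Integer.Tactic.RingSolver using (solve-∀)
import Data.List as List
import Data.List.Relation.Unary.Any as Any
import Data.List.Relation.Unary.Any.Properties as Any
open import Data.Nat as ℕ using (ℕ; zero; suc; _^_; z≤n; s≤s)
open import Data.Nat.Coprimality using (Coprime; coprime-Bézout)
import Data.Nat.DivMod as ℕ%
import Data.Nat.Divisibility as ℕ∣
open import Data.Nat.GCD using (module Bézout)
open import Data.Nat.Primality using (Prime; euclidsLemma; prime⇒irreducible; prime⇒nonTrivial; prime⇒nonZero)
import Data.Nat.Properties as ℕₚ
open import Data.Nat.Tactic.RingSolver using () renaming (solve-∀ to ℕ-solve-∀)
open import Data.Product using (∃; ∃₂; _×_; _,_; proj₁; proj₂)
open import Data.Sum using (_⊎_; inj₁; inj₂)
open import Data.Vec using (Vec; _++_; tabulate)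
open import Data.Vec.Properties using (lookup∘tabulate; lookup-++ʳ; lookup-++ˡ)
open import Function using (_∘_; id; case_of_)
open import Relation.Binary.Construct.Closure.Equivalence using (gfold; symmetric; transitive)
open import Relation.Binary.Definitions using (tri<; tri≈; tri>)
open import Relation.Binary.PropositionalEquality using (_≡_; refl; sym; trans; cong; cong₂; subst; subst₂; module ≡-Reasoning)
open import Relation.Binary.Structures using (IsEquivalence)
open import Relation.Nullary using (¬_; Dec; yes; no; contradiction)
open import Relation.Nullary.Decidable using (_×-dec_; decidable-stable)

-- The double-negation monad

infixl 1 _>>=_
_>>=_ : ∀ {a b} {A : Set a} {B : Set b} → ¬ ¬ A → (A → ¬ ¬ B) → ¬ ¬ B
(m >>= f) k = m λ x → f x k

return : ∀ {a} {A : Set a} → A → ¬ ¬ A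
return x k = k x

-- Occurrences of factors

record Agree (w : Word) (n i j : ℕ) : Set where
  constructor agreeing
  field at : ∀ x → x ℕ.< n → w (i ℕ.+ x) ≡ w (j ℕ.+ x)
open Agree

module _ {w : Word} where

  Agree-sym : ∀ {n i j} → Agree w n i j → Agree w n j i
  Agree-sym h .at x x<n = sym (at h x x<n)

  Agree-trans : ∀ {n i j l} → Agree w n i j → Agree w n j l → Agree w n i l
  Agree-trans h h′ .at x x<n = trans (at h x x<n) (at h′ x x<n)

  Agree-sub : ∀ {m n i j} a → a ℕ.+ n ℕ.≤ m → Agree w m i j → Agree w n (i ℕ.+ a) (j ℕ.+ a)
  Agree-sub {i = i} {j} a a+n≤m h .at x x<n =
    subst₂ (λ l l′ → w l ≡ w l′) (sym (ℕₚ.+-assoc i a x)) (sym (ℕₚ.+-assoc j a x))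
      (at h (a ℕ.+ x) (ℕₚ.<-≤-trans (ℕₚ.+-monoʳ-< a x<n) a+n≤m))

  Agree-prefix : ∀ {m n i j} → n ℕ.≤ m → Agree w m i j → Agree w n i j
  Agree-prefix n≤m h .at x x<n = at h x (ℕₚ.<-≤-trans x<n n≤m)

  occurs⇒agree : ∀ {n i j} (u : Vec ℕ n) → OccursAt w u i → OccursAt w u j → Agree w n i j
  occurs⇒agree {i = i} {j} u h h′ .at x x<n =
    subst (λ y → w (i ℕ.+ y) ≡ w (j ℕ.+ y)) (toℕ-fromℕ< x<n)
      (trans (h (fromℕ< x<n)) (sym (h′ (fromℕ< x<n))))

  agree⇒occurs : ∀ {n i j} (u : Vec ℕ n) → Agree w n i j → OccursAt w u j → OccursAt w u i
  agree⇒occurs u h h′ x = trans (at h (toℕ x) (toℕ<n x)) (h′ x)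

module _ (w : Word) where

  factor : ℕ → (n : ℕ) → Vec ℕ n
  factor i n = tabulate λ x → w (i ℕ.+ toℕ x)

  factor-occurs : ∀ i n → OccursAt w (factor i n) i
  factor-occurs i n x = sym (lookup∘tabulate _ x)

  occurs-++ˡ : ∀ {m n} i (u : Vec ℕ m) (v : Vec ℕ n) → OccursAt w (u ++ v) i → OccursAt w u i
  occurs-++ˡ {n = n} i u v h x =
    trans (cong (λ y → w (i ℕ.+ y)) (sym (toℕ-↑ˡ x n))) (trans (h (x Fin.↑ˡ n)) (lookup-++ˡ u v x))

  occurs-++ʳ : ∀ {m n} i (u : Vec ℕ m) (v : Vec ℕ n) → OccursAt w (u ++ v) i → OccursAt w v (i ℕ.+ m)
  occurs-++ʳ {m = m} i u v h x =
    trans (cong w (trans (ℕₚ.+-assoc i m (toℕ x)) (cong (i ℕ.+_) (sym (toℕ-↑ʳ m x)))))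
      (trans (h (m Fin.↑ʳ x)) (lookup-++ʳ u v x))

-- A factor is named by a position `i` where it occurs, and its next occurrence by an offset `o`
-- bounded uniformly in the starting position.
Recurrent : Word → Set
Recurrent w = ∀ n i → ∃ λ B → ∀ i′ → ∃ λ o → o ℕ.≤ B × Agree w n (i′ ℕ.+ o) i

recurrent : ∀ {w} → UniformlyRecurrent w → Recurrent w
recurrent {w} ur n i with ur n (factor w i n) (i , factor-occurs w i n)
... | B , next = B , λ i′ → let j , i′≤j , j≤i′+B , occ = next i′ in
  j ℕ.∸ i′ , ℕₚ.m≤n+o⇒m∸n≤o j i′ j≤i′+B ,
  subst (λ l → Agree w n l i) (sym (ℕₚ.m+[n∸m]≡n i′≤j)) (occurs⇒agree (factor w i n) occ (factor-occurs w i n))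

-- Fibres of a finite extension of a uniformly recurrent word

-- `col` plays the role of i ↦ A_{a_i} ⋯ A_{a_1} mod p^k, and the set of colours seen at the
-- occurrences of a factor is the fibre over it.
module Fibres {w : Word} (rec : Recurrent w) {Q : ℕ} (col : ℕ → Fin Q)
  (advance : ∀ a {i j} → Agree w a i j → col i ≡ col j → col (i ℕ.+ a) ≡ col (j ℕ.+ a))
  (retreat : ∀ a {i j} → Agree w a i j → col (i ℕ.+ a) ≡ col (j ℕ.+ a) → col i ≡ col j) where

  -- The fibre is never formed as a set: a lower bound on its size is a family of occurrences with
  -- pairwise different colours, an upper bound is the refutation of a larger family.
  FibreSize≥ : ℕ → ℕ → ℕ → Set
  FibreSize≥ m n i = ∃ λ (f : Fin m → ℕ) →
    (∀ a → Agree w n (f a) i) × (∀ a b → a Fin.< b → ¬ col (f a) ≡ col (f b))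

  Minimal : ℕ → Set
  Minimal m = (∃₂ λ n i → ¬ FibreSize≥ (suc m) n i) × (∀ n i → ¬ ¬ FibreSize≥ m n i)

  -- If no size were minimal, induction on `m` would make every fibre have at least `m` elements for
  -- all `m`, against the `Q` available colours.
  minimal-exists : ¬ ¬ ∃ Minimal
  minimal-exists no-min = every (suc Q) 0 0 λ (f , _ , distinct) →
    let a , b , a<b , eq = pigeonhole (ℕₚ.n<1+n Q) (col ∘ f) in distinct a b a<b eq
    where
    every : ∀ m n i → ¬ ¬ FibreSize≥ m n i
    every zero    n i k = k ((λ ()) , (λ ()) , λ ())
    every (suc m) n i k = no-min (m , (n , i , k) , every m)

  -- Every long factor contains the factor with the smallest fibre, and shifting the base point of
  -- a fibre does not change its size; so all fibres over long factors have the minimal size.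
  long-fibres : ∀ {m} → Minimal m → ∃ λ n₀ → ∀ n → n₀ ℕ.≤ n → ∀ i → ¬ FibreSize≥ (suc m) n i
  long-fibres ((n* , i* , small) , _) with rec n* i*
  ... | B , next = B ℕ.+ n* , λ n n₀≤n i (f , agree , distinct) →
    let o , o≤B , occ = next i
        inside = ℕₚ.≤-trans (ℕₚ.+-monoˡ-≤ n* o≤B) n₀≤n
    in small ((λ a → f a ℕ.+ o)
      , (λ a → Agree-trans (Agree-sub o inside (agree a)) occ)
      , λ a b a<b eq → distinct a b a<b
          (retreat o (Agree-prefix (ℕₚ.≤-trans (ℕₚ.m≤m+n o n*) inside)
            (Agree-trans (agree a) (Agree-sym (agree b)))) eq))

  -- Extending a factor of length n does not shrink its fibre.
  Extends : ℕ → Set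
  Extends n = ∀ i a b j → Agree w n j (i ℕ.+ a) →
    ¬ ¬ ∃ λ j′ → Agree w (a ℕ.+ n ℕ.+ b) j′ i × col (j′ ℕ.+ a) ≡ col j

  -- Take `m` differently coloured occurrences of the longer factor. `retreat` keeps their colours
  -- different at offset `a`; if none had the colour of `j`, then together with `j` they would give
  -- the inner factor a fibre of size `m + 1`.
  extends : ∀ {m} → Minimal m → ∃ λ n₀ → ∀ n → n₀ ℕ.≤ n → Extends n
  extends min with long-fibres min
  ... | n₀ , tight = n₀ , λ n n₀≤n i a b j j≈ → do
    (f , agree , distinct) ← proj₂ min (a ℕ.+ n ℕ.+ b) i
    let a+n≤ = ℕₚ.m≤m+n (a ℕ.+ n) b
        a≤   = ℕₚ.≤-trans (ℕₚ.m≤m+n a n) a+n≤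
    case any? (λ c → col (f c ℕ.+ a) Finₚ.≟ col j) of λ where
      (yes (c , eq)) → return (f c , agree c , eq)
      (no none) → contradiction
        ( (λ { Fin.zero → j ; (Fin.suc c) → f c ℕ.+ a })
        , (λ { Fin.zero → j≈ ; (Fin.suc c) → Agree-sub a a+n≤ (agree c) })
        , (λ { Fin.zero (Fin.suc d) _ eq → none (d , sym eq)
             ; (Fin.suc c) (Fin.suc d) (s≤s c<d) eq → distinct c d c<d
                 (retreat a (Agree-prefix a≤ (Agree-trans (agree c) (Agree-sym (agree d)))) eq) }))
        (tight n n₀≤n (i ℕ.+ a))

  extends-exists : ¬ ¬ ∃ λ n₀ → ∀ n → n₀ ℕ.≤ n → Extends n
  extends-exists = do
    (m , min) ← minimal-exists
    return (extends min)

  -- The colour is read at the end of a factor in `S` and at the start of one in `T`. For an edge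
  -- both are the position where `s` meets `t`, so the two fibres can be compared directly.
  InFibre : ∀ {n} → Vertex n → ℕ → Set
  InFibre {n} (S , s) l = ¬ ¬ ∃ λ i → OccursAt w s i × col (i ℕ.+ n) ≡ col l
  InFibre {n} (T , t) l = ¬ ¬ ∃ λ i → OccursAt w t i × col i ≡ col l

  SameFibre : ∀ {n} → Vertex n → Vertex n → Set
  SameFibre u v = ∀ l → (InFibre u l → InFibre v l) × (InFibre v l → InFibre u l)

  SameFibre-isEquivalence : ∀ {n} → IsEquivalence (SameFibre {n})
  SameFibre-isEquivalence = record
    { refl  = λ l → id , id
    ; sym   = λ h l → proj₂ (h l) , proj₁ (h l)
    ; trans = λ h h′ l → proj₁ (h′ l) ∘ proj₁ (h l) , proj₂ (h l) ∘ proj₂ (h′ l)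
    }

  -- An occurrence of `s` or of `t` need not lie in an occurrence of `st`, but `ext` replaces it by
  -- one that does and has the same colour.
  edge-sameFibre : ∀ {n} → Extends n → ∀ {u v} → Edge w n u v → SameFibre u v
  edge-sameFibre {n} ext (edge {s} {t} (i , st)) l = forth , back
    where
    s-at : OccursAt w s i
    s-at = occurs-++ˡ w i s t st
    t-at : OccursAt w t (i ℕ.+ n)
    t-at = occurs-++ʳ w i s t st
    forth : InFibre (S , s) l → InFibre (T , t) l
    forth h = do
      (i₁ , occ , eq) ← h
      (j , j≈i , eq′) ← ext i 0 n i₁ (subst (Agree w n i₁) (sym (ℕₚ.+-identityʳ i)) (occurs⇒agree s occ s-at))
      return (j ℕ.+ n , agree⇒occurs t (Agree-sub n ℕₚ.≤-refl j≈i) t-at ,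
        trans (advance n
          (Agree-trans (Agree-prefix (ℕₚ.m≤m+n n n) j≈i) (occurs⇒agree s s-at occ))
          (trans (cong col (sym (ℕₚ.+-identityʳ j))) eq′)) eq)
    back : InFibre (T , t) l → InFibre (S , s) l
    back h = do
      (i₁ , occ , eq) ← h
      (j , j≈i , eq′) ← ext i n 0 i₁ (occurs⇒agree t occ t-at)
      return (j , agree⇒occurs s (Agree-prefix (ℕₚ.≤-trans (ℕₚ.m≤m+n n n) (ℕₚ.m≤m+n (n ℕ.+ n) 0)) j≈i) s-at ,
        trans eq′ eq)

  connected-sameFibre : ∀ {n} → Extends n → ∀ {u v} → Connected w n u v → SameFibre u v
  connected-sameFibre ext = gfold SameFibre-isEquivalence id (edge-sameFibre ext)

  transfer : ∀ {n} → Extends n → ∀ i j → Connected w n (T , factor w i n) (T , factor w j n) →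
    ¬ ¬ ∃ λ j′ → Agree w n j′ i × col j′ ≡ col j
  transfer {n} ext i j conn = do
    (j′ , occ , eq) ← proj₂ (connected-sameFibre ext conn j) (return (j , factor-occurs w j n , refl))
    return (j′ , occurs⇒agree (factor w i n) occ (factor-occurs w i n) , eq)

component : ∀ {w n C} → ComponentsAtMost w n C → ∃ λ (c : ℕ → Fin C) →
  ∀ i j → c i ≡ c j → Connected w n (T , factor w i n) (T , factor w j n)
component {w} {n} (reps , short , meets) =
  (λ i → inject≤ (Any.index (rep i)) short) ,
  λ i j eq → transitive (Edge w n) (Any.lookup-index (rep i))
    (subst (λ a → Connected w n (List.lookup reps a) (T , factor w j n))
      (sym (inject≤-injective short short _ _ eq))
      (symmetric (Edge w n) (Any.lookup-index (rep j))))
  where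
  rep : ∀ i → Any.Any (Connected w n (T , factor w i n)) reps
  rep i = meets T (factor w i n) (i , factor-occurs w i n)

-- Arithmetic modulo powers of p

∣-subst : ∀ {q a b} → a ≡ b → q ∣ a → q ∣ b
∣-subst {q} = subst (q ∣_)

∣-difference : ∀ {q} a b c → q ∣ a → b ≡ a + c → q ∣ c → q ∣ b
∣-difference a b c q∣a eq q∣c = ∣-subst (sym eq) (∣m∣n⇒∣m+n q∣a q∣c)

module Primes (p : ℕ) (pp : Prime p) where

  instance
    p≢0 : ℕ.NonZero p
    p≢0 = prime⇒nonZero pp

  P : ℤ
  P = + p

  pw : ℕ → ℤ
  pw k = + (p ^ k)

  pw-suc : ∀ k → pw (suc k) ≡ P * pw k
  pw-suc k = pos-* p (p ^ k)

  pw-+ : ∀ k l → pw (k ℕ.+ l) ≡ pw k * pw l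
  pw-+ k l = trans (cong +_ (ℕₚ.^-distribˡ-+-* p k l)) (pos-* (p ^ k) (p ^ l))

  pw-mono : ∀ {k l} → k ℕ.≤ l → pw k ∣ pw l
  pw-mono {k} {l} k≤l = divides (pw (l ℕ.∸ k))
    (trans (cong pw (sym (ℕₚ.m∸n+n≡m k≤l))) (pw-+ (l ℕ.∸ k) k))

  pw0∣ : ∀ a → pw 0 ∣ a
  pw0∣ a = divides a (sym (*-identityʳ a))

  P∤1 : ¬ P ∣ 1ℤ
  P∤1 h = ℕₚ.<⇒≱ (ℕ.nonTrivial⇒n>1 p {{prime⇒nonTrivial pp}}) (ℕ∣.∣⇒≤ (∣⇒∣ᵤ h))

  euclid : ∀ a b → ¬ P ∣ a → ¬ P ∣ b → ¬ P ∣ a * b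
  euclid a b ¬a ¬b h with euclidsLemma ∣ a ∣ ∣ b ∣ pp (subst (p ℕ∣.∣_) (abs-* a b) (∣⇒∣ᵤ h))
  ... | inj₁ d = ¬a (∣ᵤ⇒∣ d)
  ... | inj₂ d = ¬b (∣ᵤ⇒∣ d)

  -- Induction on the exponent: with v = q p^k, Euclid's lemma for the product u q yields one more
  -- factor p.
  cancel-unit : ∀ k u v → ¬ P ∣ u → pw k ∣ u * v → pw k ∣ v
  cancel-unit zero    u v ¬u h = pw0∣ v
  cancel-unit (suc k) u v ¬u h with cancel-unit k u v ¬u (∣-trans (pw-mono (ℕₚ.n≤1+n k)) h)
  ... | divides q refl with P ∣? q
  ...   | yes (divides q′ refl) = divides q′ (trans (*-assoc q′ P (pw k)) (cong (q′ *_) (sym (pw-suc k))))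
  ...   | no ¬q = contradiction
    (*-cancelʳ-∣ (pw k) {{ℕₚ.m^n≢0 p k}} (subst₂ _∣_ (pw-suc k) (sym (*-assoc u q (pw k))) h)) (euclid u q ¬u ¬q)

  coprime : ∀ n → ¬ p ℕ∣.∣ n → Coprime n p
  coprime n ¬n (d∣n , d∣p) with prime⇒irreducible pp d∣p
  ... | inj₁ d≡1 = d≡1
  ... | inj₂ refl = contradiction d∣n ¬n

  ℕ-inverse : ∀ n → ¬ p ℕ∣.∣ n → ∃ λ c → P ∣ 1ℤ - c * + n
  ℕ-inverse n ¬n with coprime-Bézout (coprime n ¬n)
  ... | Bézout.Identity.+- x y eq = + x , divides (- + y) (begin
    1ℤ - + x * + n           ≡⟨ cong (λ t → 1ℤ - t) (sym (pos-* x n)) ⟩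
    1ℤ - + (x ℕ.* n)         ≡⟨ cong (λ t → 1ℤ - + t) (sym eq) ⟩
    1ℤ - + (1 ℕ.+ y ℕ.* p)   ≡⟨ cong (λ t → 1ℤ - (1ℤ + t)) (pos-* y p) ⟩
    1ℤ - (1ℤ + + y * P)      ≡⟨ ring (+ y) P ⟩
    (- + y) * P              ∎)
    where
    open ≡-Reasoning
    ring : ∀ a b → 1ℤ - (1ℤ + a * b) ≡ (- a) * b
    ring = solve-∀
  ... | Bézout.Identity.-+ x y eq = - + x , divides (+ y) (begin
    1ℤ - (- + x) * + n       ≡⟨ ring (+ x) (+ n) ⟩
    1ℤ + + x * + n           ≡⟨ cong (λ t → 1ℤ + t) (sym (pos-* x n)) ⟩
    + (1 ℕ.+ x ℕ.* n)        ≡⟨ cong +_ eq ⟩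
    + (y ℕ.* p)              ≡⟨ pos-* y p ⟩
    + y * P                  ∎)
    where
    open ≡-Reasoning
    ring : ∀ a b → 1ℤ - (- a) * b ≡ 1ℤ + a * b
    ring = solve-∀

  inverse : ∀ u → ¬ P ∣ u → ∃ λ c → P ∣ 1ℤ - c * u
  inverse (+ n) ¬u = ℕ-inverse n λ h → ¬u (∣ᵤ⇒∣ h)
  inverse -[1+ n ] ¬u with ℕ-inverse (suc n) (λ h → ¬u (∣ᵤ⇒∣ h))
  ... | c , h = - c , ∣-subst (cong (λ t → 1ℤ + - t) (ring c (+ suc n))) h
    where
    ring : ∀ a b → a * b ≡ (- a) * (- b)
    ring = solve-∀

  digit : ∀ u v → ¬ P ∣ u → ∃ λ b → b ℕ.< p × P ∣ v - + b * u
  digit u v ¬u with inverse u ¬u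
  ... | c , h = b , n%ℕd<d (v * c) p , ∣-difference _ _ _ (∣n⇒∣m*n v h) eq (∣n⇒∣m*n (((v * c) /ℕ p) * u) ∣-refl)
    where
    b = (v * c) %ℕ p
    ring : ∀ v c u b q P → v * c ≡ b + q * P → v - b * u ≡ v * (1ℤ - c * u) + q * u * P
    ring v c u b q P eq = trans (ring₁ v u b q P) (trans (cong (λ t → v - t * u + q * u * P) (sym eq)) (ring₂ v c u q P))
      where
      ring₁ : ∀ v u b q P → v - b * u ≡ v - (b + q * P) * u + q * u * P
      ring₁ = solve-∀
      ring₂ : ∀ v c u q P → v - v * c * u + q * u * P ≡ v * (1ℤ - c * u) + q * u * P
      ring₂ = solve-∀
    eq = ring v c u (+ b) ((v * c) /ℕ p) P (a≡a%ℕn+[a/ℕn]*n (v * c) p)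

  -- The residue of v/u mod p^s, built digit by digit in base p from the lowest one.
  quotient-mod : ∀ u v → ¬ P ∣ u → ∀ s → ∃ λ z → z ℕ.< p ^ s × pw s ∣ v - + z * u
  quotient-mod u v ¬u zero = 0 , ℕₚ.≤-refl , pw0∣ _
  quotient-mod u v ¬u (suc s) with quotient-mod u v ¬u s
  ... | z , z<p^s , divides q eq with digit u q ¬u
  ... | b , b<p , divides q′ eq′ = z ℕ.+ b ℕ.* p ^ s , below , divides q′ (begin
    v - + (z ℕ.+ b ℕ.* p ^ s) * u      ≡⟨ cong (λ t → v - t * u) (trans (pos-+ z _) (cong (_+_ (+ z)) (pos-* b _))) ⟩
    v - (+ z + + b * pw s) * u         ≡⟨ ring₁ v (+ z) (+ b) (pw s) u ⟩
    (v - + z * u) - + b * pw s * u     ≡⟨ cong (_- + b * pw s * u) eq ⟩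
    q * pw s - + b * pw s * u          ≡⟨ ring₂ q (+ b) (pw s) u ⟩
    (q - + b * u) * pw s               ≡⟨ cong (_* pw s) eq′ ⟩
    q′ * P * pw s                      ≡⟨ *-assoc q′ P (pw s) ⟩
    q′ * (P * pw s)                    ≡⟨ cong (q′ *_) (sym (pw-suc s)) ⟩
    q′ * pw (suc s)                    ∎)
    where
    open ≡-Reasoning
    below : z ℕ.+ b ℕ.* p ^ s ℕ.< p ^ suc s
    below = ℕₚ.<-≤-trans (ℕₚ.+-monoˡ-< (b ℕ.* p ^ s) z<p^s) (ℕₚ.*-monoˡ-≤ (p ^ s) b<p)
    ring₁ : ∀ v z b q u → v - (z + b * q) * u ≡ (v - z * u) - b * q * u
    ring₁ = solve-∀
    ring₂ : ∀ q b r u → q * r - b * r * u ≡ (q - b * u) * r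
    ring₂ = solve-∀

  valuation : ∀ r D → ¬ pw r ∣ D → ∃₂ λ s D₀ → s ℕ.< r × D ≡ pw s * D₀ × ¬ P ∣ D₀
  valuation zero D ¬D = contradiction (pw0∣ D) ¬D
  valuation (suc r) D ¬D with pw r ∣? D
  ... | no ¬D′ = let s , D₀ , s<r , eq , ¬D₀ = valuation r D ¬D′ in s , D₀ , ℕₚ.m≤n⇒m≤1+n s<r , eq , ¬D₀
  ... | yes (divides q eq) = r , q , ℕₚ.≤-refl , trans eq (*-comm q (pw r)) ,
    λ { (divides q′ eq′) → ¬D (divides q′ (trans eq (trans (cong (_* pw r) eq′)
          (trans (*-assoc q′ P (pw r)) (cong (q′ *_) (sym (pw-suc r))))))) }

  unit-+ : ∀ a {b} c → ¬ P ∣ a → b ≡ a + P * c → ¬ P ∣ b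
  unit-+ a c ¬a eq h = ¬a (∣m+n∣n⇒∣m (∣-subst eq h) (∣m⇒∣m*n c ∣-refl))

  -- Orbits of a matrix I + p²X

  -- `R` will be the set of vectors congruent mod p^k to points of one fibre, and I + p²X, with X =
  -- (a b ; c d), a transition matrix between two occurrences.
  Closed : (ℤ → ℤ → Set) → ℤ → ℤ → ℤ → ℤ → Set
  Closed R a b c d = ∀ y₁ y₂ → R y₁ y₂ →
    R (y₁ + P * P * (a * y₁ + b * y₂)) (y₂ + P * P * (c * y₁ + d * y₂))

  -- R is stable under (I + p²X)^n, which is of the form α + β p²X with α ≡ 1 and β ≡ n mod p²,
  -- because X² is a combination of X and I by Cayley–Hamilton.
  record Power (R : ℤ → ℤ → Set) (a b c d : ℤ) (n : ℕ) : Set where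
    field
      α β s t : ℤ
      α≡      : α ≡ 1ℤ + P * P * s
      β≡      : β ≡ + n + P * P * t
      stable  : ∀ y₁ y₂ → R y₁ y₂ →
        R (α * y₁ + β * (P * P * (a * y₁ + b * y₂))) (α * y₂ + β * (P * P * (c * y₁ + d * y₂)))

  power : ∀ {R a b c d} → Closed R a b c d → ∀ n → Power R a b c d n
  power {R} {a} {b} {c} {d} closed zero = record
    { α = 1ℤ ; β = 0ℤ ; s = 0ℤ ; t = 0ℤ ; α≡ = ring₁ P ; β≡ = ring₂ P
    ; stable = λ y₁ y₂ → subst₂ R (ring₃ y₁ (P * P * (a * y₁ + b * y₂))) (ring₃ y₂ (P * P * (c * y₁ + d * y₂)))
    }
    where
    ring₁ : ∀ P → 1ℤ ≡ 1ℤ + P * P * 0ℤ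
    ring₁ = solve-∀
    ring₂ : ∀ P → 0ℤ ≡ 0ℤ + P * P * 0ℤ
    ring₂ = solve-∀
    ring₃ : ∀ y e → y ≡ 1ℤ * y + 0ℤ * e
    ring₃ = solve-∀
  power {R} {a} {b} {c} {d} closed (suc n) = record
    -- The product (I + p²X)(α + βp²X), with X² replaced by (a + d)X - (ad - bc)I.
    { α = α - β * (P * P) * (P * P) * (a * d - b * c) ; β = α + β + β * (P * P) * (a + d)
    ; s = s - β * (P * P) * (a * d - b * c) ; t = s + t + β * (a + d)
    ; α≡ = α-eq P α β s (a * d - b * c) α≡
    ; β≡ = β-eq P α β s t (+ n) (a + d) α≡ β≡
    ; stable = λ y₁ y₂ r → subst₂ R (ring₁ a b c d y₁ y₂ α β (P * P)) (ring₂ a b c d y₁ y₂ α β (P * P))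
        (closed _ _ (stable y₁ y₂ r))
    }
    where
    open Power (power {R} {a} {b} {c} {d} closed n)
    α-eq : ∀ P α β s δ → α ≡ 1ℤ + P * P * s →
      α - β * (P * P) * (P * P) * δ ≡ 1ℤ + P * P * (s - β * (P * P) * δ)
    α-eq P _ β s δ refl = ring P β s δ
      where
      ring : ∀ P β s δ → 1ℤ + P * P * s - β * (P * P) * (P * P) * δ ≡ 1ℤ + P * P * (s - β * (P * P) * δ)
      ring = solve-∀
    β-eq : ∀ P α β s t n τ → α ≡ 1ℤ + P * P * s → β ≡ n + P * P * t →
      α + β + β * (P * P) * τ ≡ 1ℤ + n + P * P * (s + t + β * τ)
    β-eq P _ _ s t n τ refl refl = ring P s t n τ
      where
      ring : ∀ P s t n τ → 1ℤ + P * P * s + (n + P * P * t) + (n + P * P * t) * (P * P) * τ ≡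
        1ℤ + n + P * P * (s + t + (n + P * P * t) * τ)
      ring = solve-∀
    ring₁ : ∀ a b c d y₁ y₂ α β q →
      α * y₁ + β * (q * (a * y₁ + b * y₂)) + q * (a * (α * y₁ + β * (q * (a * y₁ + b * y₂))) + b * (α * y₂ + β * (q * (c * y₁ + d * y₂)))) ≡
      (α - β * q * q * (a * d - b * c)) * y₁ + (α + β + β * q * (a + d)) * (q * (a * y₁ + b * y₂))
    ring₁ = solve-∀
    ring₂ : ∀ a b c d y₁ y₂ α β q →
      α * y₂ + β * (q * (c * y₁ + d * y₂)) + q * (c * (α * y₁ + β * (q * (a * y₁ + b * y₂))) + d * (α * y₂ + β * (q * (c * y₁ + d * y₂)))) ≡
      (α - β * q * q * (a * d - b * c)) * y₂ + (α + β + β * q * (a + d)) * (q * (c * y₁ + d * y₂))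
    ring₂ = solve-∀

  -- Since α = 1 + p²s, the power α + βp²X equals I + p²(s + βX). It has the same shape as the
  -- original matrix, so the construction can be iterated.
  power-closed : ∀ {R a b c d n} (pow : Power R a b c d n) → let open Power pow in
    Closed R (s + β * a) (β * b) (β * c) (s + β * d)
  power-closed {R} {a} {b} {c} {d} pow y₁ y₂ r =
    subst₂ R (eq₁ a b y₁ y₂ s β (P * P) α≡) (eq₂ c d y₁ y₂ s β (P * P) α≡) (stable y₁ y₂ r)
    where
    open Power pow
    eq₁ : ∀ a b y₁ y₂ s β q {α} → α ≡ 1ℤ + q * s →
      α * y₁ + β * (q * (a * y₁ + b * y₂)) ≡ y₁ + q * ((s + β * a) * y₁ + β * b * y₂)
    eq₁ a b y₁ y₂ s β q refl = ring a b y₁ y₂ s β q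
      where
      ring : ∀ a b y₁ y₂ s β q →
        (1ℤ + q * s) * y₁ + β * (q * (a * y₁ + b * y₂)) ≡ y₁ + q * ((s + β * a) * y₁ + β * b * y₂)
      ring = solve-∀
    eq₂ : ∀ c d y₁ y₂ s β q {α} → α ≡ 1ℤ + q * s →
      α * y₂ + β * (q * (c * y₁ + d * y₂)) ≡ y₂ + q * (β * c * y₁ + (s + β * d) * y₂)
    eq₂ c d y₁ y₂ s β q refl = ring c d y₁ y₂ s β q
      where
      ring : ∀ c d y₁ y₂ s β q →
        (1ℤ + q * s) * y₂ + β * (q * (c * y₁ + d * y₂)) ≡ y₂ + q * (β * c * y₁ + (s + β * d) * y₂)
      ring = solve-∀

  -- Here v(det(Y, gY)) = s for g = I + p²X, and det(Y, Z) ≡ 0 mod p^s.  Some g^n Y is then parallel to Z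
  -- mod p^(s+1), and g^p moves it by exactly p^(s+1); iterating, the orbit of Y comes arbitrarily close to Z.
  record Moved (s : ℕ) (f₁ f₂ z₁ z₂ a b c d y₁ y₂ : ℤ) : Set where
    field
      D₀ B₀ : ℤ
      unit  : ¬ P ∣ f₁ * y₁ + f₂ * y₂
      D-unit : ¬ P ∣ D₀
      D≡ : P * P * (y₁ * (c * y₁ + d * y₂) - y₂ * (a * y₁ + b * y₂)) ≡ pw s * D₀
      B≡ : y₁ * z₂ - y₂ * z₁ ≡ pw s * B₀

  -- The step from p^s to p^(s+1). Y′ = gⁿY, where `α`, `β` are the coefficients of gⁿ, while `s₂`,
  -- `β₂` describe g^p. The linear form f = (f₁, f₂) is a unit at Y, and `n-digit` makes f(Y)
  -- det(Y′, Z) divisible by one more power of p than det(Y, Z) is known to be.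
  module HenselStep (f₁ f₂ z₁ z₂ a b c d y₁ y₂ y₁′ y₂′ α β s₁ t₁ β₂ s₂ t₂ : ℤ) (n s : ℕ)
    (α≡ : α ≡ 1ℤ + P * P * s₁) (β≡ : β ≡ + n + P * P * t₁) (β₂≡ : β₂ ≡ P + P * P * t₂)
    (y₁≡ : y₁′ ≡ α * y₁ + β * (P * P * (a * y₁ + b * y₂)))
    (y₂≡ : y₂′ ≡ α * y₂ + β * (P * P * (c * y₁ + d * y₂)))
    (mv : Moved s f₁ f₂ z₁ z₂ a b c d y₁ y₂)
    (n-digit : P ∣ Moved.B₀ mv * (f₁ * y₁ + f₂ * y₂) - + n * (Moved.D₀ mv * (f₁ * z₁ + f₂ * z₂)))
    where
    open Moved mv

    unit′ : ¬ P ∣ f₁ * y₁′ + f₂ * y₂′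
    unit′ = unit-+ (f₁ * y₁ + f₂ * y₂) _ unit
      (eq P s₁ β y₁ y₂ f₁ f₂ (a * y₁ + b * y₂) (c * y₁ + d * y₂) α≡ y₁≡ y₂≡)
      where
      eq : ∀ P s β y₁ y₂ f₁ f₂ e₁ e₂ {α y₁′ y₂′} → α ≡ 1ℤ + P * P * s →
        y₁′ ≡ α * y₁ + β * (P * P * e₁) → y₂′ ≡ α * y₂ + β * (P * P * e₂) →
        f₁ * y₁′ + f₂ * y₂′ ≡
        f₁ * y₁ + f₂ * y₂ + P * (P * (s * (f₁ * y₁ + f₂ * y₂) + β * (f₁ * e₁ + f₂ * e₂)))
      eq P s β y₁ y₂ f₁ f₂ e₁ e₂ refl refl refl = ring P s β y₁ y₂ f₁ f₂ e₁ e₂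
        where
        ring : ∀ P s β y₁ y₂ f₁ f₂ e₁ e₂ →
          f₁ * ((1ℤ + P * P * s) * y₁ + β * (P * P * e₁)) + f₂ * ((1ℤ + P * P * s) * y₂ + β * (P * P * e₂)) ≡
          f₁ * y₁ + f₂ * y₂ + P * (P * (s * (f₁ * y₁ + f₂ * y₂) + β * (f₁ * e₁ + f₂ * e₂)))
        ring = solve-∀

    -- κ is the determinant of gⁿ = α + βp²X.
    power-det : ∃ λ κ → κ ≡ α * α + α * β * (P * P * (a + d)) + β * β * (P * P * (P * P) * (a * d - b * c)) × ¬ P ∣ κ
    power-det = _ , refl , unit-+ 1ℤ _ P∤1 (eq P s₁ β (a + d) (a * d - b * c) α≡)
      where
      eq : ∀ P s β τ δ {α} → α ≡ 1ℤ + P * P * s →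
        α * α + α * β * (P * P * τ) + β * β * (P * P * (P * P) * δ) ≡
        1ℤ + P * (P * (s + s + P * P * s * s + (1ℤ + P * P * s) * β * τ + β * β * (P * P) * δ))
      eq P s β τ δ refl = ring P s β τ δ
        where
        ring : ∀ P s β τ δ →
          (1ℤ + P * P * s) * (1ℤ + P * P * s) + (1ℤ + P * P * s) * β * (P * P * τ) + β * β * (P * P * (P * P) * δ) ≡
          1ℤ + P * (P * (s + s + P * P * s * s + (1ℤ + P * P * s) * β * τ + β * β * (P * P) * δ))
        ring = solve-∀

    κ = proj₁ power-det

    D₀′ : ℤ
    D₀′ = (1ℤ + P * t₂) * κ * D₀

    D-unit′ : ¬ P ∣ D₀′
    D-unit′ = euclid ((1ℤ + P * t₂) * κ) D₀
      (euclid (1ℤ + P * t₂) κ (unit-+ 1ℤ t₂ P∤1 refl) (proj₂ (proj₂ power-det))) D-unit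

    -- The matrix gⁿ commutes with X, and adding the scalar s₂ to β₂X does not change det(Y′, ·Y′);
    -- so the determinant is multiplied by β₂κ. As β₂ is p times a unit, the valuation rises by
    -- exactly one.
    D≡′ : P * P * (y₁′ * (β₂ * c * y₁′ + (s₂ + β₂ * d) * y₂′) - y₂′ * ((s₂ + β₂ * a) * y₁′ + β₂ * b * y₂′)) ≡
      pw (suc s) * D₀′
    D≡′ = trans (eq₁ (P * P) s₂ β₂ a b c d y₁ y₂ α β y₁≡ y₂≡ (proj₁ (proj₂ power-det)))
      (trans (cong (β₂ * κ *_) D≡) (trans (eq₂ P t₂ κ (pw s) D₀ β₂≡) (cong (_* D₀′) (sym (pw-suc s)))))
      where
      ring₁ : ∀ q s β a b c d u v →
        q * (u * (β * c * u + (s + β * d) * v) - v * ((s + β * a) * u + β * b * v)) ≡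
        β * q * (u * (c * u + d * v) - v * (a * u + b * v))
      ring₁ = solve-∀
      ring₂ : ∀ α β q a b c d y₁ y₂ →
        (α * y₁ + β * (q * (a * y₁ + b * y₂))) *
            (c * (α * y₁ + β * (q * (a * y₁ + b * y₂))) + d * (α * y₂ + β * (q * (c * y₁ + d * y₂)))) -
          (α * y₂ + β * (q * (c * y₁ + d * y₂))) *
            (a * (α * y₁ + β * (q * (a * y₁ + b * y₂))) + b * (α * y₂ + β * (q * (c * y₁ + d * y₂)))) ≡
        (α * α + α * β * (q * (a + d)) + β * β * (q * q * (a * d - b * c))) *
          (y₁ * (c * y₁ + d * y₂) - y₂ * (a * y₁ + b * y₂))
      ring₂ = solve-∀
      ring₃ : ∀ β q κ e → β * q * (κ * e) ≡ β * κ * (q * e)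
      ring₃ = solve-∀
      eq₁ : ∀ q s β₂ a b c d y₁ y₂ α β {u v κ} →
        u ≡ α * y₁ + β * (q * (a * y₁ + b * y₂)) → v ≡ α * y₂ + β * (q * (c * y₁ + d * y₂)) →
        κ ≡ α * α + α * β * (q * (a + d)) + β * β * (q * q * (a * d - b * c)) →
        q * (u * (β₂ * c * u + (s + β₂ * d) * v) - v * ((s + β₂ * a) * u + β₂ * b * v)) ≡
        β₂ * κ * (q * (y₁ * (c * y₁ + d * y₂) - y₂ * (a * y₁ + b * y₂)))
      eq₁ q s β₂ a b c d y₁ y₂ α β {u} {v} {κ} refl refl κ≡ =
        trans (ring₁ q s β₂ a b c d u v)
          (trans (cong (β₂ * q *_) (trans (ring₂ α β q a b c d y₁ y₂) (cong (_* (y₁ * (c * y₁ + d * y₂) - y₂ * (a * y₁ + b * y₂))) (sym κ≡))))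
            (ring₃ β₂ q κ _))
      eq₂ : ∀ P t κ r D {β} → β ≡ P + P * P * t → β * κ * (r * D) ≡ P * r * ((1ℤ + P * t) * κ * D)
      eq₂ P t κ r D refl = ring P t κ r D
        where
        ring : ∀ P t κ r D → (P + P * P * t) * κ * (r * D) ≡ P * r * ((1ℤ + P * t) * κ * D)
        ring = solve-∀

    -- The Plücker relation expresses det(XY, Z) through det(Y, Z) and det(Y, XY).
    B-div : pw (suc s) ∣ y₁′ * z₂ - y₂′ * z₁
    B-div = cancel-unit (suc s) (f₁ * y₁ + f₂ * y₂) (y₁′ * z₂ - y₂′ * z₁) unit
      (subst₂ _∣_ (trans (*-comm (pw s) P) (sym (pw-suc s)))
        (sym (eq P s₁ t₁ (+ n) y₁ y₂ z₁ z₂ f₁ f₂ (a * y₁ + b * y₂) (c * y₁ + d * y₂) (pw s) B₀ D₀ α≡ β≡ y₁≡ y₂≡ B≡ D≡))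
        (*-monoʳ-∣ (pw s) (∣m∣n⇒∣m+n n-digit (∣m⇒∣m*n _ ∣-refl))))
      where
      ring₁ : ∀ α β q y₁ y₂ z₁ z₂ f₁ f₂ e₁ e₂ →
        (f₁ * y₁ + f₂ * y₂) * ((α * y₁ + β * (q * e₁)) * z₂ - (α * y₂ + β * (q * e₂)) * z₁) ≡
        α * ((f₁ * y₁ + f₂ * y₂) * (y₁ * z₂ - y₂ * z₁)) +
          β * ((y₁ * z₂ - y₂ * z₁) * (q * (f₁ * e₁ + f₂ * e₂)) - q * (y₁ * e₂ - y₂ * e₁) * (f₁ * z₁ + f₂ * z₂))
      ring₁ = solve-∀
      ring₂ : ∀ P s t n r B D m y z →
        (1ℤ + P * P * s) * (y * (r * B)) + (n + P * P * t) * (r * B * (P * P * m) - r * D * z) ≡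
        r * ((B * y - n * (D * z)) + P * (P * (s * (B * y) + (n + P * P * t) * (B * m) - t * (D * z))))
      ring₂ = solve-∀
      eq : ∀ P s t n y₁ y₂ z₁ z₂ f₁ f₂ e₁ e₂ r B₀ D₀ {α β y₁′ y₂′} →
        α ≡ 1ℤ + P * P * s → β ≡ n + P * P * t →
        y₁′ ≡ α * y₁ + β * (P * P * e₁) → y₂′ ≡ α * y₂ + β * (P * P * e₂) →
        y₁ * z₂ - y₂ * z₁ ≡ r * B₀ → P * P * (y₁ * e₂ - y₂ * e₁) ≡ r * D₀ →
        (f₁ * y₁ + f₂ * y₂) * (y₁′ * z₂ - y₂′ * z₁) ≡
        r * ((B₀ * (f₁ * y₁ + f₂ * y₂) - n * (D₀ * (f₁ * z₁ + f₂ * z₂))) +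
          P * (P * (s * (B₀ * (f₁ * y₁ + f₂ * y₂)) + (n + P * P * t) * (B₀ * (f₁ * e₁ + f₂ * e₂)) -
            t * (D₀ * (f₁ * z₁ + f₂ * z₂)))))
      eq P s t n y₁ y₂ z₁ z₂ f₁ f₂ e₁ e₂ r B₀ D₀ refl refl refl refl B≡ D≡ =
        trans (ring₁ (1ℤ + P * P * s) (n + P * P * t) (P * P) y₁ y₂ z₁ z₂ f₁ f₂ e₁ e₂)
          (trans (cong₂ (λ B D → (1ℤ + P * P * s) * ((f₁ * y₁ + f₂ * y₂) * B) +
                     (n + P * P * t) * (B * (P * P * (f₁ * e₁ + f₂ * e₂)) - D * (f₁ * z₁ + f₂ * z₂))) B≡ D≡)
            (ring₂ P s t n r B₀ D₀ (f₁ * e₁ + f₂ * e₂) (f₁ * y₁ + f₂ * y₂) (f₁ * z₁ + f₂ * z₂)))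

    moved : Moved (suc s) f₁ f₂ z₁ z₂ (s₂ + β₂ * a) (β₂ * b) (β₂ * c) (s₂ + β₂ * d) y₁′ y₂′
    moved = record
      { D₀ = D₀′ ; B₀ = quotient B-div ; unit = unit′ ; D-unit = D-unit′ ; D≡ = D≡′
      ; B≡ = trans (_∣_.equality B-div) (*-comm (quotient B-div) (pw (suc s))) }

  hensel : ∀ {R} l s {f₁ f₂ z₁ z₂ a b c d y₁ y₂} → ¬ P ∣ f₁ * z₁ + f₂ * z₂ → Closed R a b c d → R y₁ y₂ →
    Moved s f₁ f₂ z₁ z₂ a b c d y₁ y₂ → ∃₂ λ y₁′ y₂′ → R y₁′ y₂′ × pw (s ℕ.+ l) ∣ y₁′ * z₂ - y₂′ * z₁
  hensel zero s {y₁ = y₁} {y₂} φz-unit closed r mv =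
    y₁ , y₂ , r , divides B₀ (trans B≡ (trans (*-comm (pw s) B₀) (cong (λ k → B₀ * pw k) (sym (ℕₚ.+-identityʳ s)))))
    where open Moved mv
  hensel {R} (suc l) s {f₁} {f₂} {z₁} {z₂} {a} {b} {c} {d} {y₁} {y₂} φz-unit closed r mv =
    let y₁″ , y₂″ , r″ , h = hensel {R} l (suc s) φz-unit (power-closed {R} {a} {b} {c} {d} by-p)
                               (Power.stable by-n y₁ y₂ r) moved
    in y₁″ , y₂″ , r″ , subst (λ k → pw k ∣ y₁″ * z₂ - y₂″ * z₁) (sym (ℕₚ.+-suc s l)) h
    where
    open Moved mv using (B₀; D₀; D-unit)
    -- n solves n D₀ f(Z) ≡ B₀ f(Y) mod p, where D₀ and f(Z) are units. After moving by gⁿ the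
    -- recursion continues with g^p in place of g.
    next-digit = digit (D₀ * (f₁ * z₁ + f₂ * z₂)) (B₀ * (f₁ * y₁ + f₂ * y₂)) (euclid D₀ (f₁ * z₁ + f₂ * z₂) D-unit φz-unit)
    by-n = power {R} {a} {b} {c} {d} closed (proj₁ next-digit)
    by-p = power {R} {a} {b} {c} {d} closed p
    open HenselStep f₁ f₂ z₁ z₂ a b c d y₁ y₂ _ _
      (Power.α by-n) (Power.β by-n) (Power.s by-n) (Power.t by-n) (Power.β by-p) (Power.s by-p) (Power.t by-p)
      (proj₁ next-digit) s (Power.α≡ by-n) (Power.β≡ by-n) (Power.β≡ by-p) refl refl mv (proj₂ (proj₂ next-digit))

-- Congruences

infix 4 _≡_[_]
record _≡_[_] (a b q : ℤ) : Set where
  constructor mod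
  field difference : q ∣ a - b

mod-reflexive : ∀ {a b q} → a ≡ b → a ≡ b [ q ]
mod-reflexive {a} {q = q} refl = mod (divides 0ℤ (ring a q))
  where
  ring : ∀ a q → a - a ≡ 0ℤ * q
  ring = solve-∀

mod-sym : ∀ {a b q} → a ≡ b [ q ] → b ≡ a [ q ]
mod-sym {a} {b} (mod h) = mod (∣-subst (ring a b) (∣m⇒∣-m h))
  where
  ring : ∀ a b → - (a - b) ≡ b - a
  ring = solve-∀

mod-trans : ∀ {a b c q} → a ≡ b [ q ] → b ≡ c [ q ] → a ≡ c [ q ]
mod-trans {a} {b} {c} (mod h) (mod h′) = mod (∣-subst (ring a b c) (∣m∣n⇒∣m+n h h′))
  where
  ring : ∀ a b c → (a - b) + (b - c) ≡ a - c
  ring = solve-∀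

mod-+ : ∀ {a a′ b b′ q} → a ≡ a′ [ q ] → b ≡ b′ [ q ] → a + b ≡ a′ + b′ [ q ]
mod-+ {a} {a′} {b} {b′} (mod h) (mod h′) = mod (∣-subst (ring a a′ b b′) (∣m∣n⇒∣m+n h h′))
  where
  ring : ∀ a a′ b b′ → (a - a′) + (b - b′) ≡ a + b - (a′ + b′)
  ring = solve-∀

mod-* : ∀ {a a′ b b′ q} → a ≡ a′ [ q ] → b ≡ b′ [ q ] → a * b ≡ a′ * b′ [ q ]
mod-* {a} {a′} {b} {b′} (mod h) (mod h′) =
  mod (∣-subst (ring a a′ b b′) (∣m∣n⇒∣m+n (∣n⇒∣m*n b h) (∣n⇒∣m*n a′ h′)))
  where
  ring : ∀ a a′ b b′ → b * (a - a′) + a′ * (b - b′) ≡ a * b - a′ * b′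
  ring = solve-∀

mod-neg : ∀ {a a′ q} → a ≡ a′ [ q ] → - a ≡ - a′ [ q ]
mod-neg {a} {a′} (mod h) = mod (∣-subst (ring a a′) (∣m⇒∣-m h))
  where
  ring : ∀ a a′ → - (a - a′) ≡ - a - - a′
  ring = solve-∀

mod-weaken : ∀ {a b q q′} → q′ ∣ q → a ≡ b [ q ] → a ≡ b [ q′ ]
mod-weaken q′∣q (mod h) = mod (∣-trans q′∣q h)

mod-∣ : ∀ {a b q} → a ≡ b [ q ] → q ∣ a → q ∣ b
mod-∣ {a} {b} (mod h) q∣a = ∣-subst (ring a b) (∣m∣n⇒∣m-n q∣a h)
  where
  ring : ∀ a b → a - (a - b) ≡ b
  ring = solve-∀

det-mod : ∀ {q a a′ b b′ c c′ d d′} → a ≡ a′ [ q ] → b ≡ b′ [ q ] → c ≡ c′ [ q ] → d ≡ d′ [ q ] →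
  a * d - b * c ≡ a′ * d′ - b′ * c′ [ q ]
det-mod ha hb hc hd = mod-+ (mod-* ha hd) (mod-neg (mod-* hb hc))

%-mod : ∀ q .{{_ : ℕ.NonZero q}} m n → m ℕ.% q ≡ n ℕ.% q → + m ≡ + n [ + q ]
%-mod q m n eq = mod (divides (+ (m ℕ./ q) - + (n ℕ./ q))
  (begin
    + m - + n                             ≡⟨ cong₂ _-_ (expand m) (expand n) ⟩
    r + + (m ℕ./ q) * + q - (+ (n ℕ.% q) + + (n ℕ./ q) * + q) ≡⟨ cong (λ t → r + + (m ℕ./ q) * + q - (+ t + + (n ℕ./ q) * + q)) (sym eq) ⟩
    r + + (m ℕ./ q) * + q - (r + + (n ℕ./ q) * + q) ≡⟨ ring r (+ (m ℕ./ q)) (+ (n ℕ./ q)) (+ q) ⟩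
    (+ (m ℕ./ q) - + (n ℕ./ q)) * + q ∎))
  where
  open ≡-Reasoning
  r = + (m ℕ.% q)
  expand : ∀ m → + m ≡ + (m ℕ.% q) + + (m ℕ./ q) * + q
  expand m = trans (cong +_ (ℕ%.m≡m%n+[m/n]*n m q)) (trans (pos-+ (m ℕ.% q) _) (cong (_+_ (+ (m ℕ.% q))) (pos-* (m ℕ./ q) q)))
  ring : ∀ r a b q → r + a * q - (r + b * q) ≡ (a - b) * q
  ring = solve-∀

%-cancel : ∀ q .{{_ : ℕ.NonZero q}} {m n} → n ℕ.≤ m → + m ≡ + n [ + q ] → m ℕ.% q ≡ n ℕ.% q
%-cancel q {m} {n} n≤m (mod h) with ∣⇒∣ᵤ (∣-subst (trans (m-n≡m⊖n m n) (⊖-≥ n≤m)) h)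
... | ℕ∣.divides t eq =
  trans (cong (ℕ._% q) (trans (sym (ℕₚ.m+[n∸m]≡n n≤m)) (cong (n ℕ.+_) eq))) (ℕ%.[m+kn]%n≡m%n n t q)

mod-% : ∀ q .{{_ : ℕ.NonZero q}} m n → + m ≡ + n [ + q ] → m ℕ.% q ≡ n ℕ.% q
mod-% q m n h with ℕₚ.≤-total n m
... | inj₁ n≤m = %-cancel q n≤m h
... | inj₂ m≤n = sym (%-cancel q m≤n (mod-sym h))

-- Matrices

mul : Mat → Mat → Mat
mul (mat a b c d) (mat a′ b′ c′ d′) =
  mat (a ℕ.* a′ ℕ.+ b ℕ.* c′) (a ℕ.* b′ ℕ.+ b ℕ.* d′) (c ℕ.* a′ ℕ.+ d ℕ.* c′) (c ℕ.* b′ ℕ.+ d ℕ.* d′)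

mat-cong : ∀ {a a′ b b′ c c′ d d′} → a ≡ a′ → b ≡ b′ → c ≡ c′ → d ≡ d′ → mat a b c d ≡ mat a′ b′ c′ d′
mat-cong refl refl refl refl = refl

A·-mul : ∀ x M M′ → A· x (mul M M′) ≡ mul (A· x M) M′
A·-mul x (mat a b c d) (mat a′ b′ c′ d′) = mat-cong refl refl (ring x a b c d a′ c′) (ring x a b c d b′ d′)
  where
  ring : ∀ x a b c d e f → a ℕ.* e ℕ.+ b ℕ.* f ℕ.+ x ℕ.* (c ℕ.* e ℕ.+ d ℕ.* f) ≡ (a ℕ.+ x ℕ.* c) ℕ.* e ℕ.+ (b ℕ.+ x ℕ.* d) ℕ.* f
  ring = ℕ-solve-∀

Mpow-+ : ∀ w i a → Mpow w (i ℕ.+ a) ≡ mul (Mpow (shift i w) a) (Mpow w i)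
Mpow-+ w i zero rewrite ℕₚ.+-identityʳ i = unit (Mpow w i)
  where
  unit : ∀ M → M ≡ mul (mat 1 0 0 1) M
  unit (mat a b c d) = mat-cong (ring a c) (ring b d) (ring′ a c) (ring′ b d)
    where
    ring : ∀ a c → a ≡ 1 ℕ.* a ℕ.+ 0 ℕ.* c
    ring = ℕ-solve-∀
    ring′ : ∀ a c → c ≡ 0 ℕ.* a ℕ.+ 1 ℕ.* c
    ring′ = ℕ-solve-∀
Mpow-+ w i (suc a) rewrite ℕₚ.+-suc i a | Mpow-+ w i a = A·-mul (w (i ℕ.+ a)) (Mpow (shift i w) a) (Mpow w i)

Mpow-cong : ∀ {v w} n → (∀ x → x ℕ.< n → v x ≡ w x) → Mpow v n ≡ Mpow w n
Mpow-cong zero    h = refl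
Mpow-cong (suc n) h = cong₂ A· (h n ℕₚ.≤-refl) (Mpow-cong n λ x x<n → h x (ℕₚ.m<n⇒m<1+n x<n))

mdet : Mat → ℤ
mdet (mat a b c d) = + a * + d - + b * + c

-- Each letter contributes a determinant -1; squaring avoids tracking the sign.
Mpow-det : ∀ w n → mdet (Mpow w n) * mdet (Mpow w n) ≡ 1ℤ
Mpow-det w zero    = refl
Mpow-det w (suc n) = trans (step (w n) (Mpow w n)) (Mpow-det w n)
  where
  step : ∀ x M → mdet (A· x M) * mdet (A· x M) ≡ mdet M * mdet M
  step x (mat a b c d) = trans
    (cong₂ (λ s t → (+ c * t - + d * s) * (+ c * t - + d * s)) (cast a c) (cast b d))
    (ring (+ x) (+ a) (+ b) (+ c) (+ d))
    where
    cast : ∀ a c → + (a ℕ.+ x ℕ.* c) ≡ + a + + x * + c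
    cast a c = trans (pos-+ a (x ℕ.* c)) (cong (_+_ (+ a)) (pos-* x c))
    ring : ∀ x a b c d → (c * (b + x * d) - d * (a + x * c)) * (c * (b + x * d) - d * (a + x * c)) ≡ (a * d - b * c) * (a * d - b * c)
    ring = solve-∀

pos-dot : ∀ a b c d → + (a ℕ.* c ℕ.+ b ℕ.* d) ≡ + a * + c + + b * + d
pos-dot a b c d = trans (pos-+ (a ℕ.* c) (b ℕ.* d)) (cong₂ _+_ (pos-* a c) (pos-* b d))

row₁ row₂ : Mat → ℤ → ℤ → ℤ
row₁ M u₁ u₂ = + m11 M * u₁ + + m12 M * u₂
row₂ M u₁ u₂ = + m21 M * u₁ + + m22 M * u₂

row₁-mul : ∀ G M u₁ u₂ → row₁ (mul G M) u₁ u₂ ≡ row₁ G (row₁ M u₁ u₂) (row₂ M u₁ u₂)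
row₁-mul (mat a b c d) (mat a′ b′ c′ d′) u₁ u₂ =
  trans (cong₂ (λ s t → s * u₁ + t * u₂) (pos-dot a b a′ c′) (pos-dot a b b′ d′))
    (ring (+ a) (+ b) (+ a′) (+ b′) (+ c′) (+ d′) u₁ u₂)
  where
  ring : ∀ a b a′ b′ c′ d′ u₁ u₂ → (a * a′ + b * c′) * u₁ + (a * b′ + b * d′) * u₂ ≡
    a * (a′ * u₁ + b′ * u₂) + b * (c′ * u₁ + d′ * u₂)
  ring = solve-∀

row₂-mul : ∀ G M u₁ u₂ → row₂ (mul G M) u₁ u₂ ≡ row₂ G (row₁ M u₁ u₂) (row₂ M u₁ u₂)
row₂-mul (mat a b c d) M = row₁-mul (mat c d a b) M

record MatMod (q : ℤ) (M M′ : Mat) : Set where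
  constructor matMod
  field
    e11 : + m11 M ≡ + m11 M′ [ q ]
    e12 : + m12 M ≡ + m12 M′ [ q ]
    e21 : + m21 M ≡ + m21 M′ [ q ]
    e22 : + m22 M ≡ + m22 M′ [ q ]
open MatMod

MatMod-sym : ∀ {q M M′} → MatMod q M M′ → MatMod q M′ M
MatMod-sym (matMod a b c d) = matMod (mod-sym a) (mod-sym b) (mod-sym c) (mod-sym d)

MatMod-trans : ∀ {q M M′ M″} → MatMod q M M′ → MatMod q M′ M″ → MatMod q M M″
MatMod-trans (matMod a b c d) (matMod a′ b′ c′ d′) =
  matMod (mod-trans a a′) (mod-trans b b′) (mod-trans c c′) (mod-trans d d′)

MatMod-weaken : ∀ {q q′ M M′} → q′ ∣ q → MatMod q M M′ → MatMod q′ M M′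
MatMod-weaken h (matMod a b c d) = matMod (mod-weaken h a) (mod-weaken h b) (mod-weaken h c) (mod-weaken h d)

row₁-mod : ∀ {q M M′ u₁ u₂ u₁′ u₂′} → MatMod q M M′ → u₁ ≡ u₁′ [ q ] → u₂ ≡ u₂′ [ q ] → row₁ M u₁ u₂ ≡ row₁ M′ u₁′ u₂′ [ q ]
row₁-mod m h₁ h₂ = mod-+ (mod-* (e11 m) h₁) (mod-* (e12 m) h₂)

row₂-mod : ∀ {q M M′ u₁ u₂ u₁′ u₂′} → MatMod q M M′ → u₁ ≡ u₁′ [ q ] → u₂ ≡ u₂′ [ q ] → row₂ M u₁ u₂ ≡ row₂ M′ u₁′ u₂′ [ q ]
row₂-mod m h₁ h₂ = mod-+ (mod-* (e21 m) h₁) (mod-* (e22 m) h₂)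

MatMod-refl : ∀ {q M} → MatMod q M M
MatMod-refl = matMod (mod-reflexive refl) (mod-reflexive refl) (mod-reflexive refl) (mod-reflexive refl)

module _ {q : ℤ} where

  private
    pos-step : ∀ a x c → + (a ℕ.+ x ℕ.* c) ≡ + a + + x * + c
    pos-step a x c = trans (pos-+ a (x ℕ.* c)) (cong (_+_ (+ a)) (pos-* x c))

    step-mod : ∀ a a′ x c c′ → + a ≡ + a′ [ q ] → + c ≡ + c′ [ q ] → + (a ℕ.+ x ℕ.* c) ≡ + (a′ ℕ.+ x ℕ.* c′) [ q ]
    step-mod a a′ x c c′ h h′ = subst₂ (_≡_[ q ]) (sym (pos-step a x c)) (sym (pos-step a′ x c′))
      (mod-+ h (mod-* (mod-reflexive {+ x} refl) h′))

    step-mod⁻¹ : ∀ a a′ x c c′ → + (a ℕ.+ x ℕ.* c) ≡ + (a′ ℕ.+ x ℕ.* c′) [ q ] → + c ≡ + c′ [ q ] → + a ≡ + a′ [ q ]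
    step-mod⁻¹ a a′ x c c′ h h′ = subst₂ (_≡_[ q ]) (ring (+ a) (+ x) (+ c)) (ring (+ a′) (+ x) (+ c′))
      (mod-+ (subst₂ (_≡_[ q ]) (pos-step a x c) (pos-step a′ x c′) h)
        (mod-neg (mod-* (mod-reflexive {+ x} refl) h′)))
      where
      ring : ∀ a x c → a + x * c + - (x * c) ≡ a
      ring = solve-∀

  A·-mod : ∀ x {M M′} → MatMod q M M′ → MatMod q (A· x M) (A· x M′)
  A·-mod x {mat a b c d} {mat a′ b′ c′ d′} (matMod ha hb hc hd) =
    matMod hc hd (step-mod a a′ x c c′ ha hc) (step-mod b b′ x d d′ hb hd)

  A·-mod⁻¹ : ∀ x {M M′} → MatMod q (A· x M) (A· x M′) → MatMod q M M′
  A·-mod⁻¹ x {mat a b c d} {mat a′ b′ c′ d′} (matMod hc hd ha hb) =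
    matMod (step-mod⁻¹ a a′ x c c′ ha hc) (step-mod⁻¹ b b′ x d d′ hb hd) hc hd

  module _ {w : Word} where

    Mpow-advance : ∀ a {i j} → Agree w a i j → MatMod q (Mpow w i) (Mpow w j) → MatMod q (Mpow w (i ℕ.+ a)) (Mpow w (j ℕ.+ a))
    Mpow-advance zero {i} {j} _ h rewrite ℕₚ.+-identityʳ i | ℕₚ.+-identityʳ j = h
    Mpow-advance (suc a) {i} {j} agr h
      rewrite ℕₚ.+-suc i a | ℕₚ.+-suc j a | Agree.at agr a ℕₚ.≤-refl =
      A·-mod (w (j ℕ.+ a)) (Mpow-advance a (Agree-prefix (ℕₚ.n≤1+n a) agr) h)

    -- Every A_x is invertible over the integers, so a congruence can be pulled back along equal
    -- letters as well as pushed forward.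
    Mpow-retreat : ∀ a {i j} → Agree w a i j → MatMod q (Mpow w (i ℕ.+ a)) (Mpow w (j ℕ.+ a)) → MatMod q (Mpow w i) (Mpow w j)
    Mpow-retreat zero {i} {j} _ h rewrite ℕₚ.+-identityʳ i | ℕₚ.+-identityʳ j = h
    Mpow-retreat (suc a) {i} {j} agr h
      rewrite ℕₚ.+-suc i a | ℕₚ.+-suc j a | Agree.at agr a ℕₚ.≤-refl =
      Mpow-retreat a (Agree-prefix (ℕₚ.n≤1+n a) agr) (A·-mod⁻¹ (w (j ℕ.+ a)) h)

-- Matrices mod q as colours

Colour : ℕ → ℕ
Colour q = (q ℕ.* q) ℕ.* (q ℕ.* q)

module _ (q : ℕ) .{{_ : ℕ.NonZero q}} where

  residue : ℕ → Fin q
  residue m = fromℕ< (ℕ%.m%n<n m q)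

  colour : Mat → Fin (Colour q)
  colour (mat a b c d) = combine (combine (residue a) (residue b)) (combine (residue c) (residue d))

  residue-mod : ∀ m n → residue m ≡ residue n → + m ≡ + n [ + q ]
  residue-mod m n eq = %-mod q m n (fromℕ<-injective _ _ _ _ eq)

  mod-residue : ∀ m n → + m ≡ + n [ + q ] → residue m ≡ residue n
  mod-residue m n h = fromℕ<-cong _ _ (mod-% q m n h) _ _

  colour-mod : ∀ M M′ → colour M ≡ colour M′ → MatMod (+ q) M M′
  colour-mod (mat a b c d) (mat a′ b′ c′ d′) eq with combine-injective _ _ _ _ eq
  ... | eq₁ , eq₂ with combine-injective _ _ _ _ eq₁ | combine-injective _ _ _ _ eq₂
  ... | ha , hb | hc , hd = matMod (residue-mod a a′ ha) (residue-mod b b′ hb) (residue-mod c c′ hc) (residue-mod d d′ hd)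

  mod-colour : ∀ M M′ → MatMod (+ q) M M′ → colour M ≡ colour M′
  mod-colour (mat a b c d) (mat a′ b′ c′ d′) (matMod ha hb hc hd) =
    cong₂ combine (cong₂ combine (mod-residue a a′ ha) (mod-residue b b′ hb))
      (cong₂ combine (mod-residue c c′ hc) (mod-residue d d′ hd))

-- The determinant times the adjugate is an integral inverse, because the determinant squares to 1.
invert : ∀ {q} a b c d x y → (a * d - b * c) * (a * d - b * c) ≡ 1ℤ →
  q ∣ a * x + b * y → q ∣ c * x + d * y → (q ∣ x) × (q ∣ y)
invert a b c d x y unit h h′ =
  ∣-subst (trans (ring₁ a b c d x y) (trans (cong (_* x) unit) (one x)))
    (∣n⇒∣m*n (a * d - b * c) (∣m∣n⇒∣m-n (∣n⇒∣m*n d h) (∣n⇒∣m*n b h′))) ,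
  ∣-subst (trans (ring₂ a b c d x y) (trans (cong (_* y) unit) (one y)))
    (∣n⇒∣m*n (a * d - b * c) (∣m∣n⇒∣m-n (∣n⇒∣m*n a h′) (∣n⇒∣m*n c h)))
  where
  one : ∀ x → 1ℤ * x ≡ x
  one = solve-∀
  ring₁ : ∀ a b c d x y → (a * d - b * c) * (d * (a * x + b * y) - b * (c * x + d * y)) ≡ (a * d - b * c) * (a * d - b * c) * x
  ring₁ = solve-∀
  ring₂ : ∀ a b c d x y → (a * d - b * c) * (a * (c * x + d * y) - c * (a * x + b * y)) ≡ (a * d - b * c) * (a * d - b * c) * y
  ring₂ = solve-∀

invert-rows : ∀ {q} M u₁ u₂ → mdet M * mdet M ≡ 1ℤ → q ∣ row₁ M u₁ u₂ → q ∣ row₂ M u₁ u₂ → (q ∣ u₁) × (q ∣ u₂)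
invert-rows (mat a b c d) u₁ u₂ = invert (+ a) (+ b) (+ c) (+ d) u₁ u₂

invert-columns : ∀ {q} a b c d x y → mdet (mat a b c d) * mdet (mat a b c d) ≡ 1ℤ →
  q ∣ + a * x + + c * y → q ∣ + b * x + + d * y → (q ∣ x) × (q ∣ y)
invert-columns a b c d x y unit =
  invert (+ a) (+ c) (+ b) (+ d) x y (trans (cong (λ t → (+ a * + d - t) * (+ a * + d - t)) (*-comm (+ c) (+ b))) unit)

-- G = I + qX with X = (a b ; c d).
record NearIdentity (q : ℤ) (G : Mat) : Set where
  field
    a b c d : ℤ
    act₁ : ∀ y₁ y₂ → row₁ G y₁ y₂ ≡ y₁ + q * (a * y₁ + b * y₂)
    act₂ : ∀ y₁ y₂ → row₂ G y₁ y₂ ≡ y₂ + q * (c * y₁ + d * y₂)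

near-row₁ : ∀ q g h x x′ → g - 1ℤ ≡ x * q → h ≡ x′ * q → ∀ y₁ y₂ → g * y₁ + h * y₂ ≡ y₁ + q * (x * y₁ + x′ * y₂)
near-row₁ q g h x x′ e e′ y₁ y₂ =
  trans (ring₁ g h y₁ y₂) (trans (cong₂ (λ s t → y₁ + (s * y₁ + t * y₂)) e e′) (ring₂ x x′ q y₁ y₂))
  where
  ring₁ : ∀ g h y₁ y₂ → g * y₁ + h * y₂ ≡ y₁ + ((g - 1ℤ) * y₁ + h * y₂)
  ring₁ = solve-∀
  ring₂ : ∀ x x′ q y₁ y₂ → y₁ + (x * q * y₁ + x′ * q * y₂) ≡ y₁ + q * (x * y₁ + x′ * y₂)
  ring₂ = solve-∀

near-row₂ : ∀ q g h x x′ → g ≡ x * q → h - 1ℤ ≡ x′ * q → ∀ y₁ y₂ → g * y₁ + h * y₂ ≡ y₂ + q * (x * y₁ + x′ * y₂)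
near-row₂ q g h x x′ e e′ y₁ y₂ =
  trans (ring₁ g h y₁ y₂) (trans (cong₂ (λ s t → y₂ + (s * y₁ + t * y₂)) e e′) (ring₂ x x′ q y₁ y₂))
  where
  ring₁ : ∀ g h y₁ y₂ → g * y₁ + h * y₂ ≡ y₂ + (g * y₁ + (h - 1ℤ) * y₂)
  ring₁ = solve-∀
  ring₂ : ∀ x x′ q y₁ y₂ → y₂ + (x * q * y₁ + x′ * q * y₂) ≡ y₂ + q * (x * y₁ + x′ * y₂)
  ring₂ = solve-∀

near-entry₁ : ∀ {q} g h a c → + (g ℕ.* a ℕ.+ h ℕ.* c) ≡ + a [ q ] → q ∣ + a * (+ g - 1ℤ) + + c * + h
near-entry₁ g h a c (mod e) = ∣-subst (trans (cong (_- + a) (pos-dot g h a c)) (ring (+ g) (+ h) (+ a) (+ c))) e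
  where
  ring : ∀ g h a c → g * a + h * c - a ≡ a * (g - 1ℤ) + c * h
  ring = solve-∀

near-entry₂ : ∀ {q} g h a c → + (g ℕ.* a ℕ.+ h ℕ.* c) ≡ + c [ q ] → q ∣ + a * + g + + c * (+ h - 1ℤ)
near-entry₂ g h a c (mod e) = ∣-subst (trans (cong (_- + c) (pos-dot g h a c)) (ring (+ g) (+ h) (+ a) (+ c))) e
  where
  ring : ∀ g h a c → g * a + h * c - c ≡ a * g + c * (h - 1ℤ)
  ring = solve-∀

fromQuotients : ∀ {q} g₁ g₂ g₃ g₄ → (q ∣ + g₁ - 1ℤ) × (q ∣ + g₂) → (q ∣ + g₃) × (q ∣ + g₄ - 1ℤ) →
  NearIdentity q (mat g₁ g₂ g₃ g₄)
fromQuotients {q} g₁ g₂ g₃ g₄ (divides a e₁ , divides b e₂) (divides c e₃ , divides d e₄) = record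
  { a = a ; b = b ; c = c ; d = d
  ; act₁ = near-row₁ q (+ g₁) (+ g₂) a b e₁ e₂ ; act₂ = near-row₂ q (+ g₃) (+ g₄) c d e₃ e₄ }

-- From GM ≡ M follows (G - I)M ≡ 0, and M is invertible.
nearIdentity : ∀ {q} G M → mdet M * mdet M ≡ 1ℤ → MatMod q (mul G M) M → NearIdentity q G
nearIdentity (mat g₁ g₂ g₃ g₄) (mat a b c d) unit (matMod e11 e12 e21 e22) = fromQuotients g₁ g₂ g₃ g₄
  (invert-columns a b c d (+ g₁ - 1ℤ) (+ g₂) unit (near-entry₁ g₁ g₂ a c e11) (near-entry₁ g₁ g₂ b d e12))
  (invert-columns a b c d (+ g₃) (+ g₄ - 1ℤ) unit (near-entry₂ g₃ g₄ a c e21) (near-entry₂ g₃ g₄ b d e22))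

-- Rational points of small height near an orbit

module Approximation (p : ℕ) (pp : Prime p) where
  open Primes p pp

  record ShortParallel (s : ℕ) (y₁ y₂ : ℤ) : Set where
    field
      f₁ f₂ z₁ z₂ : ℤ
      y-unit   : ¬ P ∣ f₁ * y₁ + f₂ * y₂
      z-unit   : ¬ P ∣ f₁ * z₁ + f₂ * z₂
      parallel : pw s ∣ y₁ * z₂ - y₂ * z₁
      small₁   : ∣ z₁ ∣ ℕ.≤ p ^ s
      small₂   : ∣ z₂ ∣ ℕ.≤ p ^ s

  -- In the affine chart given by a unit coordinate of y, the point y is a single residue, and its
  -- representative below p^s gives z. The form f is that coordinate and equals 1 at z.
  shortParallel : ∀ s y₁ y₂ → ¬ ((P ∣ y₁) × (P ∣ y₂)) → ShortParallel s y₁ y₂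
  shortParallel s y₁ y₂ prim with P ∣? y₂
  ... | no ¬y₂ = let z , z<p^s , h = quotient-mod y₂ y₁ ¬y₂ s in record
    { f₁ = 0ℤ ; f₂ = 1ℤ ; z₁ = + z ; z₂ = 1ℤ
    ; y-unit = λ h → ¬y₂ (∣-subst (ring₁ y₁ y₂) h)
    ; z-unit = λ h → P∤1 (∣-subst (ring₁ (+ z) 1ℤ) h)
    ; parallel = ∣-subst (ring₂ y₁ y₂ (+ z)) h
    ; small₁ = ℕₚ.<⇒≤ z<p^s ; small₂ = ℕₚ.m^n>0 p s }
    where
    ring₁ : ∀ y₁ y₂ → 0ℤ * y₁ + 1ℤ * y₂ ≡ y₂
    ring₁ = solve-∀
    ring₂ : ∀ y₁ y₂ z → y₁ - z * y₂ ≡ y₁ * 1ℤ - y₂ * z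
    ring₂ = solve-∀
  ... | yes y₂-div = let ¬y₁ = λ y₁-div → prim (y₁-div , y₂-div)
                         z , z<p^s , h = quotient-mod y₁ y₂ ¬y₁ s in record
    { f₁ = 1ℤ ; f₂ = 0ℤ ; z₁ = 1ℤ ; z₂ = + z
    ; y-unit = λ h → ¬y₁ (∣-subst (ring₁ y₁ y₂) h)
    ; z-unit = λ h → P∤1 (∣-subst (ring₁ 1ℤ (+ z)) h)
    ; parallel = ∣-subst (ring₂ y₁ y₂ (+ z)) (∣m⇒∣-m h)
    ; small₁ = ℕₚ.m^n>0 p s ; small₂ = ℕₚ.<⇒≤ z<p^s }
    where
    ring₁ : ∀ y₁ y₂ → 1ℤ * y₁ + 0ℤ * y₂ ≡ y₁
    ring₁ = solve-∀
    ring₂ : ∀ y₁ y₂ z → - (y₂ - z * y₁) ≡ y₁ * z - y₂ * 1ℤ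
    ring₂ = solve-∀

  n<p^n : ∀ n → n ℕ.< p ^ n
  n<p^n zero = s≤s z≤n
  n<p^n (suc n) = ℕₚ.<-≤-trans (s≤s (n<p^n n)) (ℕₚ.^-monoʳ-< p (ℕ.nonTrivial⇒n>1 p {{prime⇒nonTrivial pp}}) (ℕₚ.n<1+n n))

  -- The configuration that contradicts the PBad inequality. That inequality is applied to the form
  -- det(·, z), with coefficients z₂ and -z₁; hence the shape of `nonzero`.
  record Escape (R : ℤ → ℤ → Set) (r k : ℕ) : Set where
    field
      s           : ℕ
      y₁ y₂ z₁ z₂ : ℤ
      s<r         : s ℕ.< r
      small₁      : ∣ z₁ ∣ ℕ.≤ p ^ s
      small₂      : ∣ z₂ ∣ ℕ.≤ p ^ s
      nonzero     : ¬ (z₂ ≡ 0ℤ × - z₁ ≡ 0ℤ)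
      reached     : R y₁ y₂
      parallel    : pw k ∣ y₁ * z₂ - y₂ * z₁

  -- Let s < r be the valuation of det(Y, GY). The ball of radius p^(-s) around Y contains a
  -- rational point of height at most p^s, and `hensel` moves Y along its orbit to that point up to
  -- precision p^k.
  escape : ∀ {R : ℤ → ℤ → Set} {r k G y₁ y₂} → r ℕ.≤ k → NearIdentity (P * P) G → ¬ ((P ∣ y₁) × (P ∣ y₂)) →
    (∀ z₁ z₂ → R z₁ z₂ → R (row₁ G z₁ z₂) (row₂ G z₁ z₂)) → R y₁ y₂ →
    ¬ pw r ∣ y₁ * row₂ G y₁ y₂ - y₂ * row₁ G y₁ y₂ → Escape R r k
  escape {R} {r} {k} {G} {y₁} {y₂} r≤k near prim closed here far = go near
    where
    ring : ∀ q y₁ y₂ a b c d → y₁ * (y₂ + q * (c * y₁ + d * y₂)) - y₂ * (y₁ + q * (a * y₁ + b * y₂)) ≡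
      q * (y₁ * (c * y₁ + d * y₂) - y₂ * (a * y₁ + b * y₂))
    ring = solve-∀
    go : NearIdentity (P * P) G → Escape R r k
    go record { a = a ; b = b ; c = c ; d = d ; act₁ = act₁ ; act₂ = act₂ }
      with valuation r (y₁ * row₂ G y₁ y₂ - y₂ * row₁ G y₁ y₂) far
    ... | s , D₀ , s<r , D≡ , D-unit = assemble (shortParallel s y₁ y₂ prim)
      where
      assemble : ShortParallel s y₁ y₂ → Escape R r k
      assemble record { f₁ = f₁ ; f₂ = f₂ ; z₁ = z₁ ; z₂ = z₂ ; y-unit = y-unit ; z-unit = z-unit
                      ; parallel = divides B₀ B≡ ; small₁ = small₁ ; small₂ = small₂ } =
        let y₁′ , y₂′ , reached , par = hensel {R} (k ℕ.∸ s) s {f₁} {f₂} {z₁} {z₂} {a} {b} {c} {d} {y₁} {y₂} z-unit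
              (λ v₁ v₂ r → subst₂ R (act₁ v₁ v₂) (act₂ v₁ v₂) (closed v₁ v₂ r)) here
              (record { D₀ = D₀ ; B₀ = B₀ ; unit = y-unit ; D-unit = D-unit
                      ; D≡ = trans (sym (trans (cong₂ (λ e₁ e₂ → y₁ * e₂ - y₂ * e₁) (act₁ y₁ y₂) (act₂ y₁ y₂)) (ring (P * P) y₁ y₂ a b c d))) D≡
                      ; B≡ = trans B≡ (*-comm B₀ (pw s)) })
        in record
          { s = s ; y₁ = y₁′ ; y₂ = y₂′ ; z₁ = z₁ ; z₂ = z₂ ; s<r = s<r ; small₁ = small₁ ; small₂ = small₂
          ; nonzero = λ (z₂≡0 , -z₁≡0) → z-unit (divides 0ℤ (trans
              (trans (ring₁ f₁ f₂ z₁ z₂) (cong₂ (λ s t → - (f₁ * s) + f₂ * t) -z₁≡0 z₂≡0)) (ring₂ f₁ f₂ P)))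
          ; reached = reached
          ; parallel = subst (λ l → pw l ∣ y₁′ * z₂ - y₂′ * z₁) (ℕₚ.m+[n∸m]≡n (ℕₚ.≤-trans (ℕₚ.<⇒≤ s<r) r≤k)) par
          }
        where
        ring₁ : ∀ f₁ f₂ z₁ z₂ → f₁ * z₁ + f₂ * z₂ ≡ - (f₁ * (- z₁)) + f₂ * z₂
        ring₁ = solve-∀
        ring₂ : ∀ f₁ f₂ P → - (f₁ * 0ℤ) + f₂ * 0ℤ ≡ 0ℤ * P
        ring₂ = solve-∀

  -- The orbit of x modulo powers of p

  module Orbit {w : Word} (rec : Recurrent w) (u₁ u₂ : ℕ → ℤ)
    (u₁-compat : ∀ K → u₁ (suc K) ≡ u₁ K [ pw K ]) (u₂-compat : ∀ K → u₂ (suc K) ≡ u₂ K [ pw K ])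
    (u-primitive : ∀ K → ¬ ((P ∣ u₁ (suc K)) × (P ∣ u₂ (suc K)))) where

    -- Coordinates of y_n at precision p^K, where `u₁ K`, `u₂ K` are primitive coordinates of x mod
    -- p^K. Primitivity is phrased with `suc K` because precision p⁰ carries no information.
    y₁ y₂ : ℕ → ℕ → ℤ
    y₁ n K = row₁ (Mpow w n) (u₁ K) (u₂ K)
    y₂ n K = row₂ (Mpow w n) (u₁ K) (u₂ K)

    -- The PBad inequality in primitive coordinates, with `δ` an upper bound for 1/ε.
    Bad : ℕ → Set
    Bad δ = ∀ n K a b → ¬ (a ≡ 0ℤ × b ≡ 0ℤ) → pw K ∣ a * y₁ n K + b * y₂ n K → p ^ K ℕ.≤ δ ℕ.* (∣ a ∣ ℕ.⊔ ∣ b ∣) ^ 2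

    y-primitive : ∀ n K → ¬ ((P ∣ y₁ n (suc K)) × (P ∣ y₂ n (suc K)))
    y-primitive n K (h , h′) = u-primitive K (invert-rows (Mpow w n) (u₁ (suc K)) (u₂ (suc K)) (Mpow-det w n) h h′)

    level : ∀ (u : ℕ → ℤ) → (∀ K → u (suc K) ≡ u K [ pw K ]) → ∀ r d → u (d ℕ.+ r) ≡ u r [ pw r ]
    level u compat r zero    = mod-reflexive refl
    level u compat r (suc d) = mod-trans (mod-weaken (pw-mono (ℕₚ.m≤n+m r d)) (compat (d ℕ.+ r))) (level u compat r d)

    y₁-level : ∀ n r d → y₁ n (d ℕ.+ r) ≡ y₁ n r [ pw r ]
    y₁-level n r d = row₁-mod {M = Mpow w n} MatMod-refl (level u₁ u₁-compat r d) (level u₂ u₂-compat r d)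

    y₂-level : ∀ n r d → y₂ n (d ℕ.+ r) ≡ y₂ n r [ pw r ]
    y₂-level n r d = row₂-mod {M = Mpow w n} MatMod-refl (level u₁ u₁-compat r d) (level u₂ u₂-compat r d)

    -- y_i and y_j are the same point of P¹ mod p^r, computed at precision K.
    SamePoint : ℕ → ℕ → ℕ → ℕ → Set
    SamePoint r K i j = pw r ∣ y₁ i K * y₂ j K - y₂ i K * y₁ j K

    SamePoint-sym : ∀ {r K} i j → SamePoint r K i j → SamePoint r K j i
    SamePoint-sym {r} {K} i j h = ∣-subst (ring (y₁ i K) (y₂ i K) (y₁ j K) (y₂ j K)) (∣m⇒∣-m h)
      where
      ring : ∀ a b c d → - (a * d - b * c) ≡ c * b - d * a
      ring = solve-∀

    SamePoint-level : ∀ r d i j → SamePoint r (d ℕ.+ r) i j → SamePoint r r i j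
    SamePoint-level r d i j = mod-∣ (det-mod (y₁-level i r d) (y₂-level i r d) (y₁-level j r d) (y₂-level j r d))

    SamePoint-mod : ∀ {r K i j j′} → MatMod (pw r) (Mpow w j) (Mpow w j′) → SamePoint r K i j → SamePoint r K i j′
    SamePoint-mod {r} {K} {i} {j} {j′} h = mod-∣ (det-mod (mod-reflexive {y₁ i K} refl) (mod-reflexive {y₂ i K} refl)
      (row₁-mod h (mod-reflexive {u₁ K} refl) (mod-reflexive {u₂ K} refl))
      (row₂-mod h (mod-reflexive {u₁ K} refl) (mod-reflexive {u₂ K} refl)))

    module Level (k : ℕ) where
      instance
        p^k≢0 : ℕ.NonZero (p ^ k)
        p^k≢0 = ℕₚ.m^n≢0 p k

      col : ℕ → Fin (Colour (p ^ k))
      col i = colour (p ^ k) (Mpow w i)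

      col-mod : ∀ i j → col i ≡ col j → MatMod (pw k) (Mpow w i) (Mpow w j)
      col-mod i j = colour-mod (p ^ k) (Mpow w i) (Mpow w j)

      open Fibres rec col
        (λ a {i} {j} agr eq → mod-colour (p ^ k) _ _ (Mpow-advance a agr (col-mod i j eq)))
        (λ a {i} {j} agr eq → mod-colour (p ^ k) _ _ (Mpow-retreat a agr (col-mod (i ℕ.+ a) (j ℕ.+ a) eq)))
        public

      -- Two occurrences of a long factor at which the matrices agree mod p² carry the same point
      -- mod p^r: otherwise the orbit of the point under the transition matrix, which stays inside
      -- the fibre, would come too close to a rational point of small height.
      rigid : ∀ {δ} → Bad δ → ∀ r → k ≡ suc (suc δ) ℕ.+ (r ℕ.+ r) → ∀ {n} → Extends n → ∀ i a → Agree w n (i ℕ.+ a) i →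
        MatMod (P * P) (Mpow w (i ℕ.+ a)) (Mpow w i) → SamePoint r k i (i ℕ.+ a)
      rigid {δ} bad r k≡ {n} ext i a agr h with pw r ∣? (y₁ i k * y₂ (i ℕ.+ a) k - y₂ i k * y₁ (i ℕ.+ a) k)
      ... | yes same = same
      ... | no differ = contradiction (escape {R} {r} {k} {G} {y₁ i k} {y₂ i k} r≤k near prim closed here far) impossible
        where
        G : Mat
        G = Mpow (shift i w) a

        -- The points seen at the occurrences of the factor at `i`, as vectors mod p^k.
        R : ℤ → ℤ → Set
        R z₁ z₂ = ¬ ¬ ∃ λ l → Agree w n l i × z₁ ≡ y₁ l k [ pw k ] × z₂ ≡ y₂ l k [ pw k ]

        r≤k : r ℕ.≤ k
        r≤k = subst (r ℕ.≤_) (sym k≡) (ℕₚ.≤-trans (ℕₚ.m≤m+n r r) (ℕₚ.m≤n+m (r ℕ.+ r) (suc (suc δ))))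

        near : NearIdentity (P * P) G
        near = nearIdentity G (Mpow w i) (Mpow-det w i) (subst (λ M → MatMod (P * P) M (Mpow w i)) (Mpow-+ w i a) h)

        prim : ¬ ((P ∣ y₁ i k) × (P ∣ y₂ i k))
        prim = subst (λ K → ¬ ((P ∣ y₁ i K) × (P ∣ y₂ i K))) (sym k≡) (y-primitive i _)

        move₁ : ∀ l → Mpow (shift l w) a ≡ G → y₁ (l ℕ.+ a) k ≡ row₁ G (y₁ l k) (y₂ l k)
        move₁ l eq = trans (cong (λ M → row₁ M (u₁ k) (u₂ k)) (trans (Mpow-+ w l a) (cong (λ M → mul M (Mpow w l)) eq)))
          (row₁-mul G (Mpow w l) (u₁ k) (u₂ k))

        move₂ : ∀ l → Mpow (shift l w) a ≡ G → y₂ (l ℕ.+ a) k ≡ row₂ G (y₁ l k) (y₂ l k)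
        move₂ l eq = trans (cong (λ M → row₂ M (u₁ k) (u₂ k)) (trans (Mpow-+ w l a) (cong (λ M → mul M (Mpow w l)) eq)))
          (row₂-mul G (Mpow w l) (u₁ k) (u₂ k))

        here : R (y₁ i k) (y₂ i k)
        here = return (i , agreeing (λ _ _ → refl) , mod-reflexive {y₁ i k} refl , mod-reflexive {y₂ i k} refl)

        congruent₁ : ∀ {z} l l′ → MatMod (pw k) (Mpow w l) (Mpow w l′) → z ≡ y₁ l k [ pw k ] → z ≡ y₁ l′ k [ pw k ]
        congruent₁ {z} l l′ h h₁ = mod-trans {z} {y₁ l k} {y₁ l′ k} h₁
          (row₁-mod {M = Mpow w l} {Mpow w l′} {u₁ k} {u₂ k} {u₁ k} {u₂ k} h (mod-reflexive refl) (mod-reflexive refl))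

        congruent₂ : ∀ {z} l l′ → MatMod (pw k) (Mpow w l) (Mpow w l′) → z ≡ y₂ l k [ pw k ] → z ≡ y₂ l′ k [ pw k ]
        congruent₂ {z} l l′ h h₂ = mod-trans {z} {y₂ l k} {y₂ l′ k} h₂
          (row₂-mod {M = Mpow w l} {Mpow w l′} {u₁ k} {u₂ k} {u₁ k} {u₂ k} h (mod-reflexive refl) (mod-reflexive refl))

        moved : ∀ {z₁ z₂} l → Mpow (shift l w) a ≡ G → z₁ ≡ y₁ l k [ pw k ] → z₂ ≡ y₂ l k [ pw k ] →
          (row₁ G z₁ z₂ ≡ y₁ (l ℕ.+ a) k [ pw k ]) × (row₂ G z₁ z₂ ≡ y₂ (l ℕ.+ a) k [ pw k ])
        moved {z₁} {z₂} l eq h₁ h₂ =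
          subst (row₁ G z₁ z₂ ≡_[ pw k ]) (sym (move₁ l eq)) (row₁-mod {M = G} {G} {z₁} {z₂} {y₁ l k} {y₂ l k} MatMod-refl h₁ h₂) ,
          subst (row₂ G z₁ z₂ ≡_[ pw k ]) (sym (move₂ l eq)) (row₂-mod {M = G} {G} {z₁} {z₂} {y₁ l k} {y₂ l k} MatMod-refl h₁ h₂)

        closed : ∀ z₁ z₂ → R z₁ z₂ → R (row₁ G z₁ z₂) (row₂ G z₁ z₂)
        closed z₁ z₂ reach = do
          (l , l≈i , h₁ , h₂) ← reach
          -- Some l′ has the matrix of l mod p^k and is followed by the same n + a letters as i.
          -- Reading the first a of them applies G and leads to the factor found at i + a, which is
          -- the one at i again.
          (l′ , l′≈i , eq) ← ext i 0 a l (subst (Agree w n l) (sym (ℕₚ.+-identityʳ i)) l≈i)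
          let h = MatMod-sym (subst (λ m → MatMod (pw k) (Mpow w m) (Mpow w l)) (ℕₚ.+-identityʳ l′) (col-mod (l′ ℕ.+ 0) l eq))
              same-word = Mpow-cong a λ x x<a → Agree.at l′≈i x (ℕₚ.<-≤-trans x<a (ℕₚ.m≤n+m a n))
          return (l′ ℕ.+ a , Agree-trans (Agree-sub a (ℕₚ.≤-reflexive (ℕₚ.+-comm a n)) l′≈i) agr ,
            moved l′ same-word (congruent₁ l l′ h h₁) (congruent₂ l l′ h h₂))

        far : ¬ pw r ∣ y₁ i k * row₂ G (y₁ i k) (y₂ i k) - y₂ i k * row₁ G (y₁ i k) (y₂ i k)
        far h = differ (∣-subst (cong₂ (λ e₁ e₂ → y₁ i k * e₂ - y₂ i k * e₁) (sym (move₁ i refl)) (sym (move₂ i refl))) h)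

        impossible : ¬ Escape R r k
        impossible record { s = s ; z₁ = z₁ ; z₂ = z₂ ; s<r = s<r ; small₁ = small₁ ; small₂ = small₂
                          ; nonzero = nonzero ; reached = reached ; parallel = parallel } =
          reached λ (l , _ , h₁ , h₂) → ℕₚ.<⇒≱ too-small (bad l k z₂ (- z₁) nonzero
            (∣-subst (ring (y₁ l k) (y₂ l k) z₁ z₂) (mod-∣ (det-mod h₁ h₂ (mod-reflexive {z₁} refl) (mod-reflexive {z₂} refl)) parallel)))
          where
          ring : ∀ y₁ y₂ z₁ z₂ → y₁ * z₂ - y₂ * z₁ ≡ z₂ * y₁ + (- z₁) * y₂
          ring = solve-∀
          open ℕₚ.≤-Reasoning
          small : ∣ z₂ ∣ ℕ.⊔ ∣ - z₁ ∣ ℕ.≤ p ^ r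
          small = ℕₚ.≤-trans (ℕₚ.⊔-lub small₂ (subst (ℕ._≤ p ^ s) (sym (∣-i∣≡∣i∣ z₁)) small₁))
            (ℕₚ.^-monoʳ-≤ p (ℕₚ.<⇒≤ s<r))
          -- In k the part 2r pays for the square of the height bound p^r, and p^(δ+2) > δ absorbs
          -- the constant.
          too-small : δ ℕ.* (∣ z₂ ∣ ℕ.⊔ ∣ - z₁ ∣) ^ 2 ℕ.< p ^ k
          too-small = begin-strict
            δ ℕ.* (∣ z₂ ∣ ℕ.⊔ ∣ - z₁ ∣) ^ 2   ≤⟨ ℕₚ.*-monoʳ-≤ δ (ℕₚ.^-monoˡ-≤ 2 small) ⟩
            δ ℕ.* (p ^ r) ^ 2                 ≡⟨ cong (λ t → δ ℕ.* (p ^ r ℕ.* t)) (ℕₚ.*-identityʳ (p ^ r)) ⟩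
            δ ℕ.* (p ^ r ℕ.* p ^ r)           ≡⟨ cong (δ ℕ.*_) (sym (ℕₚ.^-distribˡ-+-* p r r)) ⟩
            δ ℕ.* p ^ (r ℕ.+ r)               <⟨ ℕₚ.*-monoˡ-< (p ^ (r ℕ.+ r)) {{ℕₚ.m^n≢0 p (r ℕ.+ r)}}
                                                  (ℕₚ.≤-<-trans (ℕₚ.m≤n+m δ 2) (n<p^n (suc (suc δ)))) ⟩
            p ^ suc (suc δ) ℕ.* p ^ (r ℕ.+ r) ≡⟨ sym (ℕₚ.^-distribˡ-+-* p (suc (suc δ)) (r ℕ.+ r)) ⟩
            p ^ (suc (suc δ) ℕ.+ (r ℕ.+ r))   ≡⟨ cong (p ^_) (sym k≡) ⟩
            p ^ k                             ∎

    SamePoint-antitone : ∀ {r r′} i j → r ℕ.≤ r′ → SamePoint r′ r′ i j → SamePoint r r i j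
    SamePoint-antitone {r} {r′} i j r≤r′ h = SamePoint-level r (r′ ℕ.∸ r) i j
      (∣-trans (pw-mono r≤r′) (subst (λ K → SamePoint r′ K i j) (sym (ℕₚ.m∸n+n≡m r≤r′)) h))

    module _ {δ : ℕ} (bad : Bad δ) where

      rigid-unordered : ∀ r {n} → let k = suc (suc δ) ℕ.+ (r ℕ.+ r) in Level.Extends k n → ∀ i j → Agree w n j i →
        MatMod (P * P) (Mpow w j) (Mpow w i) → SamePoint r k i j
      rigid-unordered r {n} ext i j agr h with ℕₚ.≤-total i j
      ... | inj₁ i≤j = subst (SamePoint r k i) (ℕₚ.m+[n∸m]≡n i≤j) (Level.rigid k {δ} bad r refl ext i (j ℕ.∸ i)
          (subst (λ l → Agree w n l i) (sym (ℕₚ.m+[n∸m]≡n i≤j)) agr)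
          (subst (λ l → MatMod (P * P) (Mpow w l) (Mpow w i)) (sym (ℕₚ.m+[n∸m]≡n i≤j)) h))
        where k = suc (suc δ) ℕ.+ (r ℕ.+ r)
      ... | inj₂ j≤i = SamePoint-sym {r} {k} j i (subst (SamePoint r k j) (ℕₚ.m+[n∸m]≡n j≤i) (Level.rigid k {δ} bad r refl ext j (i ℕ.∸ j)
          (subst (λ l → Agree w n l j) (sym (ℕₚ.m+[n∸m]≡n j≤i)) (Agree-sym agr))
          (subst (λ l → MatMod (P * P) (Mpow w l) (Mpow w j)) (sym (ℕₚ.m+[n∸m]≡n j≤i)) (MatMod-sym h))))
        where k = suc (suc δ) ℕ.+ (r ℕ.+ r)

      -- The number of positions does not depend on `r`. Two of them, i and j, share a component and
      -- a matrix mod p²; connectedness yields an occurrence j′ of the factor at i with the matrix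
      -- of j mod p^k, and rigidity compares i with j′.
      few-points : ∀ {C} → (∀ n → ComponentsAtMost w n C) → ∀ r (f : Fin (suc (C ℕ.* Colour (p ^ 2))) → ℕ) →
        ¬ ¬ ∃₂ λ a b → a Fin.< b × SamePoint r r (f a) (f b)
      few-points {C} comps r f = do
        (n , ext) ← extends-exists
        let E = ext n ℕₚ.≤-refl
            c , connected = component (comps n)
            a , b , a<b , eq = pigeonhole (ℕₚ.n<1+n _) (λ x → combine (c (f x)) (colour (p ^ 2) {{ℕₚ.m^n≢0 p 2}} (Mpow w (f x))))
            i = f a
            j = f b
            c≡ , col≡ = combine-injective _ _ _ _ eq
        (j′ , j′≈i , eq′) ← transfer E i j (connected i j c≡)
        let j′≡j = col-mod j′ j eq′
            j≡i  = MatMod-sym (colour-mod (p ^ 2) {{ℕₚ.m^n≢0 p 2}} (Mpow w i) (Mpow w j) col≡)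
            same = rigid-unordered r E i j′ j′≈i
              (MatMod-trans (MatMod-weaken (∣-trans P²∣ (pw-mono 2≤k)) j′≡j) (MatMod-weaken P²∣ j≡i))
        return (a , b , a<b , SamePoint-level r (suc (suc δ) ℕ.+ r) i j
          (subst (λ K → SamePoint r K i j) (sym (ℕₚ.+-assoc (suc (suc δ)) r r))
            (SamePoint-mod {r} {k} {i} {j′} {j} (MatMod-weaken (pw-mono r≤k) j′≡j) same)))
        where
        k = suc (suc δ) ℕ.+ (r ℕ.+ r)
        open Level k
        -- Congruence of the matrices at j′ and j mod p^k thus implies congruence mod p², as
        -- rigidity requires.
        2≤k : 2 ℕ.≤ k
        2≤k = s≤s (s≤s z≤n)
        r≤k : r ℕ.≤ k
        r≤k = ℕₚ.≤-trans (ℕₚ.m≤m+n r r) (ℕₚ.m≤n+m (r ℕ.+ r) (suc (suc δ)))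
        P²∣ : P * P ∣ pw 2
        P²∣ = ∣-reflexive (trans (sym (pos-* p p)) (cong (λ t → + (p ℕ.* t)) (sym (ℕₚ.*-identityʳ p))))

-- Infinite pigeonhole

-- Double negation commutes with finite conjunctions, and monotonicity lets the largest of the
-- finitely many bounds serve for all.
common-bound : ∀ m (R : Fin m → ℕ → Set) → (∀ a {r r′} → r ℕ.≤ r′ → R a r → R a r′) →
  (∀ a → ¬ ¬ ∃ (R a)) → ∀ r₀ → ¬ ¬ ∃ λ r → r₀ ℕ.≤ r × ∀ a → R a r
common-bound zero    R mono h r₀ = return (r₀ , ℕₚ.≤-refl , λ ())
common-bound (suc m) R mono h r₀ = do
  (r , Rr) ← h Fin.zero
  (r′ , r₀⊔r≤r′ , all) ← common-bound m (λ a → R (Fin.suc a)) (λ a → mono (Fin.suc a)) (λ a → h (Fin.suc a)) (r₀ ℕ.⊔ r)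
  return (r′ , ℕₚ.≤-trans (ℕₚ.m≤m⊔n r₀ r) r₀⊔r≤r′ ,
    λ { Fin.zero → mono Fin.zero (ℕₚ.≤-trans (ℕₚ.m≤n⊔m r₀ r) r₀⊔r≤r′) Rr ; (Fin.suc a) → all a })

module InfinitePigeonhole (E : ℕ → ℕ → ℕ → Set) (E? : ∀ r i j → Dec (E r i j))
  (E-sym : ∀ {r} i j → E r i j → E r j i)
  (antitone : ∀ {r r′} i j → r ℕ.≤ r′ → E r′ i j → E r i j) where

  Equal : ℕ → ℕ → Set
  Equal i j = ∀ r → E r i j

  record Separated (m : ℕ) : Set where
    field
      f        : Fin m → ℕ
      r B      : ℕ
      distinct : ∀ a b → a Fin.< b → ¬ E r (f a) (f b)
      last     : ∀ a j → B ℕ.≤ j → ¬ Equal (f a) j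

  separate : ∀ i j → ¬ Equal i j → ¬ ¬ ∃ λ r → ¬ E r i j
  separate i j h k = h λ r → decide r (E? r i j)
    where
    decide : ∀ r → Dec (E r i j) → E r i j
    decide r (yes e) = e
    decide r (no ne) = contradiction (r , ne) k

  -- If every index had only finitely many equals, pairwise unequal indices could be chosen
  -- greedily, each beyond the equals of the earlier ones. One level `r` would separate `Q` of them,
  -- against the hypothesis at that level.
  recurring-class : ∀ {Q} → (∀ r (f : Fin Q → ℕ) → ¬ ¬ ∃₂ λ a b → a Fin.< b × E r (f a) (f b)) →
    ¬ ¬ ∃ λ i → ∀ B → ¬ ¬ ∃ λ j → B ℕ.≤ j × Equal i j
  recurring-class {Q} few none = separated Q λ s → few (Separated.r s) (Separated.f s)
    λ (a , b , a<b , e) → Separated.distinct s a b a<b e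
    where
    eventually : ∀ i → ¬ ¬ ∃ λ B → ∀ j → B ℕ.≤ j → ¬ Equal i j
    eventually i k = none (i , λ B no-j → k (B , λ j B≤j eq → no-j (j , B≤j , eq)))
    separated : ∀ m → ¬ ¬ Separated m
    separated zero = return (record { f = λ () ; r = 0 ; B = 0 ; distinct = λ () ; last = λ () })
    separated (suc m) = do
      s ← separated m
      let open Separated s
      -- `B` itself becomes the next index, since it lies beyond all equals of the earlier ones.
      (r′ , r≤r′ , apart) ← common-bound m (λ a r → ¬ E r (f a) B)
        (λ a r≤r′ ne e → ne (antitone (f a) B r≤r′ e)) (λ a → separate (f a) B (last a B ℕₚ.≤-refl)) r
      (B′ , last′) ← eventually B
      return (record
        { f = λ { Fin.zero → B ; (Fin.suc a) → f a }
        ; r = r′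
        ; B = B ℕ.⊔ B′
        ; distinct = λ { Fin.zero (Fin.suc b) _ e → apart b (E-sym B (f b) e)
                       ; (Fin.suc a) (Fin.suc b) (s≤s a<b) e → distinct a b a<b (antitone (f a) (f b) r≤r′ e) }
        ; last = λ { Fin.zero j h → last′ j (ℕₚ.≤-trans (ℕₚ.m≤n⊔m B B′) h)
                   ; (Fin.suc a) j h → last a j (ℕₚ.≤-trans (ℕₚ.m≤m⊔n B B′) h) }
        })

-- The monoid generated by the matrices A_a is free

Positive : Word → Set
Positive v = ∀ x → 1 ℕ.≤ v x

-- The coordinates of M (1,2)ᵀ: with this starting vector the second coordinate always dominates
-- the first, so that the last letter can be recovered by Euclidean division.
σ₁ σ₂ : Mat → ℕ
σ₁ M = m11 M ℕ.+ 2 ℕ.* m12 M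
σ₂ M = m21 M ℕ.+ 2 ℕ.* m22 M

σ₂-A· : ∀ x M → σ₂ (A· x M) ≡ σ₁ M ℕ.+ x ℕ.* σ₂ M
σ₂-A· x (mat a b c d) = ring x a b c d
  where
  ring : ∀ x a b c d → a ℕ.+ x ℕ.* c ℕ.+ 2 ℕ.* (b ℕ.+ x ℕ.* d) ≡ a ℕ.+ 2 ℕ.* b ℕ.+ x ℕ.* (c ℕ.+ 2 ℕ.* d)
  ring = ℕ-solve-∀

σ-increasing : ∀ {v} → Positive v → ∀ n → 0 ℕ.< σ₁ (Mpow v n) × σ₁ (Mpow v n) ℕ.< σ₂ (Mpow v n)
σ-increasing {v} pos zero    = s≤s z≤n , s≤s (s≤s z≤n)
σ-increasing {v} pos (suc n) = ℕₚ.≤-<-trans z≤n (proj₂ ih) , subst (σ₂ M ℕ.<_) (sym (σ₂-A· (v n) M))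
  (ℕₚ.+-mono-≤ (proj₁ ih) (ℕₚ.m≤n*m (σ₂ M) (v n) {{ℕ.>-nonZero (pos n)}}))
  where
  M = Mpow v n
  ih = σ-increasing pos n

division-≤ : ∀ {s s′ t x x′} → s ℕ.< t → s ℕ.+ x ℕ.* t ≡ s′ ℕ.+ x′ ℕ.* t → ¬ x ℕ.< x′
division-≤ {s} {s′} {t} {x} {x′} s<t eq x<x′ = ℕₚ.<-irrefl eq (begin-strict
  s ℕ.+ x ℕ.* t   <⟨ ℕₚ.+-monoˡ-< (x ℕ.* t) s<t ⟩
  suc x ℕ.* t   ≤⟨ ℕₚ.*-monoˡ-≤ t x<x′ ⟩
  x′ ℕ.* t      ≤⟨ ℕₚ.m≤n+m (x′ ℕ.* t) s′ ⟩
  s′ ℕ.+ x′ ℕ.* t ∎)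
  where open ℕₚ.≤-Reasoning

division-unique : ∀ {s s′ t x x′} → s ℕ.< t → s′ ℕ.< t → s ℕ.+ x ℕ.* t ≡ s′ ℕ.+ x′ ℕ.* t → x ≡ x′
division-unique {s} {s′} {t} {x} {x′} s<t s′<t eq with ℕₚ.<-cmp x x′
... | tri< x<x′ _ _ = contradiction x<x′ (division-≤ {s} {s′} {t} s<t eq)
... | tri≈ _ x≡x′ _ = x≡x′
... | tri> _ _ x>x′ = contradiction x>x′ (division-≤ {s′} {s} {t} s′<t (sym eq))

A·-injective : ∀ x M M′ → A· x M ≡ A· x M′ → M ≡ M′
A·-injective x (mat a b c d) (mat a′ b′ c′ d′) eq with cong m11 eq | cong m12 eq
... | refl | refl = mat-cong (ℕₚ.+-cancelʳ-≡ (x ℕ.* c) a a′ (cong m21 eq)) (ℕₚ.+-cancelʳ-≡ (x ℕ.* d) b b′ (cong m22 eq)) refl refl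

Mpow-injective : ∀ {v v′} → Positive v → Positive v′ → ∀ n → Mpow v n ≡ Mpow v′ n → ∀ x → x ℕ.< n → v x ≡ v′ x
Mpow-injective {v} {v′} pos pos′ (suc n) eq x (s≤s x≤n) = go (ℕₚ.m≤n⇒m<n∨m≡n x≤n)
  where
  M  = Mpow v n
  M′ = Mpow v′ n
  -- `A·` moves the second row to the first, so `σ₁` of the product is `σ₂ M`.
  same-σ₂ : σ₂ M ≡ σ₂ M′
  same-σ₂ = cong σ₁ eq
  letter : v n ≡ v′ n
  letter = division-unique (proj₂ (σ-increasing pos n)) (subst (σ₁ M′ ℕ.<_) (sym same-σ₂) (proj₂ (σ-increasing pos′ n)))
    (trans (sym (σ₂-A· (v n) M)) (trans (cong σ₂ eq) (trans (σ₂-A· (v′ n) M′) (cong (λ t → σ₁ M′ ℕ.+ v′ n ℕ.* t) (sym same-σ₂)))))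
  go : x ℕ.< n ⊎ x ≡ n → v x ≡ v′ x
  go (inj₁ x<n) = Mpow-injective pos pos′ n (A·-injective (v n) M M′ (trans eq (cong (λ a → A· a M′) (sym letter)))) x x<n
  go (inj₂ refl) = letter

-- Concatenation and commuting words

cat : ℕ → Word → Word → Word
cat zero    u v x       = v x
cat (suc n) u v zero    = u zero
cat (suc n) u v (suc x) = cat n (shift 1 u) v x

cat-left : ∀ n u v x → x ℕ.< n → cat n u v x ≡ u x
cat-left (suc n) u v zero    _         = refl
cat-left (suc n) u v (suc x) (s≤s x<n) = cat-left n (shift 1 u) v x x<n

cat-right : ∀ n u v x → cat n u v (n ℕ.+ x) ≡ v x
cat-right zero    u v x = refl
cat-right (suc n) u v x = cat-right n (shift 1 u) v x

cat-positive : ∀ n {u v} → Positive u → Positive v → Positive (cat n u v)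
cat-positive zero    pu pv x       = pv x
cat-positive (suc n) pu pv zero    = pu zero
cat-positive (suc n) pu pv (suc x) = cat-positive n (λ y → pu (suc y)) pv x

Mpow-cat : ∀ m n u v → Mpow (cat m u v) (m ℕ.+ n) ≡ mul (Mpow v n) (Mpow u m)
Mpow-cat m n u v = trans (Mpow-+ (cat m u v) m n)
  (cong₂ mul (Mpow-cong n λ x _ → cat-right m u v x) (Mpow-cong m λ x → cat-left m u v x))

-- The prefixes of lengths q and l, concatenated in either order, have equal products and hence are
-- equal words. The letter at q + x is `u x` in one order and `u (q + x)` in the other.
commuting-prefixes : ∀ {u} → Positive u → ∀ q l → mul (Mpow u q) (Mpow u l) ≡ mul (Mpow u l) (Mpow u q) →
  ∀ x → q ℕ.+ x ℕ.< l → u (q ℕ.+ x) ≡ u x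
commuting-prefixes {u} pos q l comm x q+x<l = trans (sym (cat-left l u u (q ℕ.+ x) q+x<l))
  (trans (sym (Mpow-injective (cat-positive q pos pos) (cat-positive l pos pos) (q ℕ.+ l) eq (q ℕ.+ x) (ℕₚ.<-≤-trans q+x<l (ℕₚ.m≤n+m l q))))
    (cat-right q u u x))
  where
  eq : Mpow (cat q u u) (q ℕ.+ l) ≡ Mpow (cat l u u) (q ℕ.+ l)
  eq = trans (Mpow-cat q l u u) (trans (sym comm)
    (trans (sym (Mpow-cat l q u u)) (cong (Mpow (cat l u u)) (ℕₚ.+-comm l q))))

-- Positivity of entries

m11+m21>0 : ∀ {v} → Positive v → ∀ n → 0 ℕ.< m11 (Mpow v n) ℕ.+ m21 (Mpow v n)
m21>0 : ∀ {v} → Positive v → ∀ n → 0 ℕ.< m21 (Mpow v (suc n))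
m11+m21>0 pos zero    = s≤s z≤n
m11+m21>0 {v} pos (suc n) = ℕₚ.≤-trans (m21>0 pos n) (ℕₚ.m≤n+m _ (m11 (Mpow v (suc n))))
m21>0 {v} pos n = ℕₚ.≤-trans (m11+m21>0 pos n) (ℕₚ.+-monoʳ-≤ (m11 (Mpow v n)) (ℕₚ.m≤n*m (m21 (Mpow v n)) (v n) {{ℕ.>-nonZero (pos n)}}))

m22>0 : ∀ {v} → Positive v → ∀ n → 0 ℕ.< m22 (Mpow v n)
m22>0 pos zero = s≤s z≤n
m22>0 {v} pos (suc n) = ℕₚ.≤-trans (m22>0 pos n)
  (ℕₚ.≤-trans (ℕₚ.m≤n*m (m22 (Mpow v n)) (v n) {{ℕ.>-nonZero (pos n)}}) (ℕₚ.m≤n+m _ (m12 (Mpow v n))))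

-- Any prefix of w occurs again after `i₀`, where the period already holds.
eventually-periodic⇒periodic : ∀ {w} → Recurrent w → ∀ i₀ q → 0 ℕ.< q → (∀ x → w (i₀ ℕ.+ (q ℕ.+ x)) ≡ w (i₀ ℕ.+ x)) → Periodic w
eventually-periodic⇒periodic {w} rec i₀ q 0<q per = q , 0<q , λ i →
  let _ , next = rec (suc (q ℕ.+ i)) 0
      o , _ , agr = next i₀
  in trans (sym (Agree.at agr (q ℕ.+ i) ℕₚ.≤-refl))
       (trans (cong w (rearrange₁ i₀ o q i))
         (trans (per (o ℕ.+ i)) (trans (cong w (sym (ℕₚ.+-assoc i₀ o i))) (Agree.at agr i (s≤s (ℕₚ.m≤n+m i q))))))
  where
  rearrange₁ : ∀ i₀ o q i → i₀ ℕ.+ o ℕ.+ (q ℕ.+ i) ≡ i₀ ℕ.+ (q ℕ.+ (o ℕ.+ i))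
  rearrange₁ = ℕ-solve-∀

pos*≡0 : ∀ {n} i → 0 ℕ.< n → + n * i ≡ 0ℤ → i ≡ 0ℤ
pos*≡0 {suc n} i _ eq with i*j≡0⇒i≡0∨j≡0 (+ suc n) eq
... | inj₂ i≡0 = i≡0

-- y is a common zero of the forms det(y, Gy) = γ y₁² + (δ−α) y₁y₂ − β y₂² and det(y, G′y);
-- c₁, c₂, c₃ are the 2×2 minors of their coefficients, which vanish iff G and G′ commute.
module Commutator (α β γ δ α′ β′ γ′ δ′ : ℕ) where
  c₁ = + γ′ * (+ δ - + α) - + γ * (+ δ′ - + α′)
  c₂ = + γ * + β′ - + γ′ * + β
  c₃ = + β′ * (+ δ - + α) - + β * (+ δ′ - + α′)

  -- Up to sign the minors form the cross product of the two coefficient vectors, which is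
  -- orthogonal to the first of them, (γ, δ - α, -β).
  minor-relation : + γ * c₃ ≡ + β * c₁ + c₂ * (+ δ - + α)
  minor-relation = ring (+ α) (+ β) (+ γ) (+ δ) (+ α′) (+ β′) (+ γ′) (+ δ′)
    where
    ring : ∀ α β γ δ α′ β′ γ′ δ′ → γ * (β′ * (δ - α) - β * (δ′ - α′)) ≡
      β * (γ′ * (δ - α) - γ * (δ′ - α′)) + (γ * β′ - γ′ * β) * (δ - α)
    ring = solve-∀

  commute : c₁ ≡ 0ℤ → c₂ ≡ 0ℤ → c₃ ≡ 0ℤ → mul (mat α β γ δ) (mat α′ β′ γ′ δ′) ≡ mul (mat α′ β′ γ′ δ′) (mat α β γ δ)
  commute h₁ h₂ h₃ = mat-cong
    (entry α β α′ γ′ α′ β′ α γ (- c₂) (ring₁ (+ α) (+ β) (+ γ) (+ α′) (+ β′) (+ γ′)) (cong -_ h₂))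
    (entry α β β′ δ′ α′ β′ β δ (- c₃) (ring₂ (+ α) (+ β) (+ δ) (+ α′) (+ β′) (+ δ′)) (cong -_ h₃))
    (entry γ δ α′ γ′ γ′ δ′ α γ c₁ (ring₃ (+ α) (+ γ) (+ δ) (+ α′) (+ γ′) (+ δ′)) h₁)
    (entry γ δ β′ δ′ γ′ δ′ β δ c₂ (ring₄ (+ β) (+ γ) (+ δ) (+ β′) (+ γ′) (+ δ′)) h₂)
    where
    entry : ∀ a b c d a′ b′ c′ d′ e → + a * + c + + b * + d - (+ a′ * + c′ + + b′ * + d′) ≡ e → e ≡ 0ℤ →
      a ℕ.* c ℕ.+ b ℕ.* d ≡ a′ ℕ.* c′ ℕ.+ b′ ℕ.* d′
    entry a b c d a′ b′ c′ d′ e eq e≡0 = +-injective (trans (pos-dot a b c d)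
      (trans (i-j≡0⇒i≡j (+ a * + c + + b * + d) (+ a′ * + c′ + + b′ * + d′) (trans eq e≡0)) (sym (pos-dot a′ b′ c′ d′))))
    ring₁ : ∀ α β γ α′ β′ γ′ → α * α′ + β * γ′ - (α′ * α + β′ * γ) ≡ - (γ * β′ - γ′ * β)
    ring₁ = solve-∀
    ring₂ : ∀ α β δ α′ β′ δ′ → α * β′ + β * δ′ - (α′ * β + β′ * δ) ≡ - (β′ * (δ - α) - β * (δ′ - α′))
    ring₂ = solve-∀
    ring₃ : ∀ α γ δ α′ γ′ δ′ → γ * α′ + δ * γ′ - (γ′ * α + δ′ * γ) ≡ γ′ * (δ - α) - γ * (δ′ - α′)
    ring₃ = solve-∀
    ring₄ : ∀ β γ δ β′ γ′ δ′ → γ * β′ + δ * δ′ - (γ′ * β + δ′ * δ) ≡ γ * β′ - γ′ * β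
    ring₄ = solve-∀

  module _ {q y₁ y₂ : ℤ}
    (h  : q ∣ y₁ * (+ γ * y₁ + + δ * y₂) - y₂ * (+ α * y₁ + + β * y₂))
    (h′ : q ∣ y₁ * (+ γ′ * y₁ + + δ′ * y₂) - y₂ * (+ α′ * y₁ + + β′ * y₂)) where

    -- Eliminating y₁² from the two quadratic forms leaves y₂ times a linear form, which
    -- irrationality of y can then force to vanish.
    eliminate₁ : q ∣ y₂ * (c₁ * y₁ + c₂ * y₂)
    eliminate₁ = ∣-subst (ring (+ α) (+ β) (+ γ) (+ δ) (+ α′) (+ β′) (+ γ′) (+ δ′) y₁ y₂)
      (∣m∣n⇒∣m-n (∣n⇒∣m*n (+ γ′) h) (∣n⇒∣m*n (+ γ) h′))
      where
      ring : ∀ α β γ δ α′ β′ γ′ δ′ y₁ y₂ →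
        γ′ * (y₁ * (γ * y₁ + δ * y₂) - y₂ * (α * y₁ + β * y₂)) - γ * (y₁ * (γ′ * y₁ + δ′ * y₂) - y₂ * (α′ * y₁ + β′ * y₂)) ≡
        y₂ * ((γ′ * (δ - α) - γ * (δ′ - α′)) * y₁ + (γ * β′ - γ′ * β) * y₂)
      ring = solve-∀

    eliminate₂ : q ∣ y₁ * (c₂ * y₁ + c₃ * y₂)
    eliminate₂ = ∣-subst (ring (+ α) (+ β) (+ γ) (+ δ) (+ α′) (+ β′) (+ γ′) (+ δ′) y₁ y₂)
      (∣m∣n⇒∣m-n (∣n⇒∣m*n (+ β′) h) (∣n⇒∣m*n (+ β) h′))
      where
      ring : ∀ α β γ δ α′ β′ γ′ δ′ y₁ y₂ →
        β′ * (y₁ * (γ * y₁ + δ * y₂) - y₂ * (α * y₁ + β * y₂)) - β * (y₁ * (γ′ * y₁ + δ′ * y₂) - y₂ * (α′ * y₁ + β′ * y₂)) ≡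
        y₁ * ((γ * β′ - γ′ * β) * y₁ + (β′ * (δ - α) - β * (δ′ - α′)) * y₂)
      ring = solve-∀

  module _ (β>0 : 0 ℕ.< β) (γ>0 : 0 ℕ.< γ) where

    commute₁ : c₁ ≡ 0ℤ → c₂ ≡ 0ℤ → mul (mat α β γ δ) (mat α′ β′ γ′ δ′) ≡ mul (mat α′ β′ γ′ δ′) (mat α β γ δ)
    commute₁ h₁ h₂ = commute h₁ h₂ (pos*≡0 c₃ γ>0
      (trans minor-relation (trans (cong₂ (λ s t → + β * s + t * (+ δ - + α)) h₁ h₂) (ring (+ β) (+ δ - + α)))))
      where
      ring : ∀ b e → b * 0ℤ + 0ℤ * e ≡ 0ℤ
      ring = solve-∀

    commute₂ : c₂ ≡ 0ℤ → c₃ ≡ 0ℤ → mul (mat α β γ δ) (mat α′ β′ γ′ δ′) ≡ mul (mat α′ β′ γ′ δ′) (mat α β γ δ)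
    commute₂ h₂ h₃ = commute (pos*≡0 c₁ β>0 (trans (ring₁ (+ β * c₁) (c₂ * (+ δ - + α)))
      (trans (cong (_- c₂ * (+ δ - + α)) (sym minor-relation))
        (trans (cong₂ (λ s t → + γ * s - t * (+ δ - + α)) h₃ h₂) (ring₂ (+ γ) (+ δ - + α)))))) h₂ h₃
      where
      ring₁ : ∀ a b → a ≡ a + b - b
      ring₁ = solve-∀
      ring₂ : ∀ b e → b * 0ℤ - 0ℤ * e ≡ 0ℤ
      ring₂ = solve-∀

-- Common stabilisers and periodicity

module Conclusion (p : ℕ) (pp : Prime p) where
  open Primes p pp
  open Approximation p pp

  -- The hypotheses say that the point y of P¹(ℚ_p), given by its approximations (y₁ r , y₂ r), is irrational
  -- and fixed by G and G′.
  stabilisers-commute : (y₁ y₂ : ℕ → ℤ) → (∀ r → ¬ ((P ∣ y₁ r) × (P ∣ y₂ r))) → (size : ℤ → ℤ → ℕ) →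
    (∀ r a b → size a b ℕ.≤ r → pw (suc r) ∣ a * y₁ r + b * y₂ r → a ≡ 0ℤ × b ≡ 0ℤ) →
    ∀ G G′ → 0 ℕ.< m12 G → 0 ℕ.< m21 G →
    (∀ r → pw (suc r) ∣ y₁ r * row₂ G (y₁ r) (y₂ r) - y₂ r * row₁ G (y₁ r) (y₂ r)) →
    (∀ r → pw (suc r) ∣ y₁ r * row₂ G′ (y₁ r) (y₂ r) - y₂ r * row₁ G′ (y₁ r) (y₂ r)) →
    mul G G′ ≡ mul G′ G
  stabilisers-commute y₁ y₂ prim size irrational (mat α β γ δ) (mat α′ β′ γ′ δ′) β>0 γ>0 h h′ = decide (P ∣? y₂ r)
    where
    open Commutator α β γ δ α′ β′ γ′ δ′
    -- One precision suffices for both linear forms; the unit coordinate of y decides which of them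
    -- is used.
    r = size c₁ c₂ ℕ.+ size c₂ c₃
    decide : Dec (P ∣ y₂ r) → _
    decide (no ¬y₂) =
      let c₁≡0 , c₂≡0 = irrational r c₁ c₂ (ℕₚ.m≤m+n (size c₁ c₂) (size c₂ c₃))
                          (cancel-unit (suc r) (y₂ r) (c₁ * y₁ r + c₂ * y₂ r) ¬y₂ (eliminate₁ {y₁ = y₁ r} {y₂ r} (h r) (h′ r)))
      in commute₁ β>0 γ>0 c₁≡0 c₂≡0
    decide (yes y₂-div) =
      let c₂≡0 , c₃≡0 = irrational r c₂ c₃ (ℕₚ.m≤n+m (size c₂ c₃) (size c₁ c₂))
                          (cancel-unit (suc r) (y₁ r) (c₂ * y₁ r + c₃ * y₂ r) (λ y₁-div → prim r (y₁-div , y₂-div))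
                            (eliminate₂ {y₁ = y₁ r} {y₂ r} (h r) (h′ r)))
      in commute₂ β>0 γ>0 c₂≡0 c₃≡0

  module _ {w : Word} (rec : Recurrent w) (u₁ u₂ : ℕ → ℤ)
    (u₁-compat : ∀ K → u₁ (suc K) ≡ u₁ K [ pw K ]) (u₂-compat : ∀ K → u₂ (suc K) ≡ u₂ K [ pw K ])
    (u-primitive : ∀ K → ¬ ((P ∣ u₁ (suc K)) × (P ∣ u₂ (suc K)))) where
    open Orbit rec u₁ u₂ u₁-compat u₂-compat u-primitive

    module _ {δ : ℕ} (bad : Bad δ) (positive : Positive w) where

      -- A nonzero form divisible by p^(r+1) would give r + 1 < p^(r+1) ≤ r.
      irrational : ∀ i r a b → δ ℕ.* (∣ a ∣ ℕ.⊔ ∣ b ∣) ^ 2 ℕ.≤ r →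
        pw (suc r) ∣ a * y₁ i (suc r) + b * y₂ i (suc r) → a ≡ 0ℤ × b ≡ 0ℤ
      irrational i r a b small h with (a ℤ.≟ 0ℤ) ×-dec (b ℤ.≟ 0ℤ)
      ... | yes both≡0 = both≡0
      ... | no nonzero = contradiction
        (ℕₚ.≤-trans (ℕₚ.<⇒≤ (n<p^n (suc r))) (ℕₚ.≤-trans (bad i (suc r) a b nonzero h) small)) (ℕₚ.<⇒≱ (ℕₚ.n<1+n r))

      -- The three positions carry one point of P¹(ℤ_p), so both transition matrices fix it.
      returns-commute : ∀ i a b → (∀ r → SamePoint r r i (i ℕ.+ suc a)) → (∀ r → SamePoint r r i (i ℕ.+ suc b)) →
        mul (Mpow (shift i w) (suc a)) (Mpow (shift i w) (suc b)) ≡ mul (Mpow (shift i w) (suc b)) (Mpow (shift i w) (suc a))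
      returns-commute i a b ha hb = stabilisers-commute (λ r → y₁ i (suc r)) (λ r → y₂ i (suc r)) (y-primitive i)
        (λ a b → δ ℕ.* (∣ a ∣ ℕ.⊔ ∣ b ∣) ^ 2) (irrational i) (Mpow (shift i w) (suc a)) (Mpow (shift i w) (suc b))
        -- The entry m12 of the product of length `suc a` is the entry m22 of the product of length
        -- `a`.
        (m22>0 (λ x → positive (i ℕ.+ x)) a) (m21>0 (λ x → positive (i ℕ.+ x)) a)
        (λ r → fixed (suc a) (suc r) (ha (suc r))) (λ r → fixed (suc b) (suc r) (hb (suc r)))
        where
        fixed : ∀ a K → SamePoint K K i (i ℕ.+ a) → let G = Mpow (shift i w) a in
          pw K ∣ y₁ i K * row₂ G (y₁ i K) (y₂ i K) - y₂ i K * row₁ G (y₁ i K) (y₂ i K)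
        fixed a K = ∣-subst (cong₂ (λ e₁ e₂ → y₁ i K * e₂ - y₂ i K * e₁)
          (trans (cong (λ M → row₁ M (u₁ K) (u₂ K)) (Mpow-+ w i a)) (row₁-mul (Mpow (shift i w) a) (Mpow w i) (u₁ K) (u₂ K)))
          (trans (cong (λ M → row₂ M (u₁ K) (u₂ K)) (Mpow-+ w i a)) (row₂-mul (Mpow (shift i w) a) (Mpow w i) (u₁ K) (u₂ K))))

      open InfinitePigeonhole (λ r → SamePoint r r) (λ r i j → pw r ∣? _)
        (λ {r} i j → SamePoint-sym {r} {r} i j) SamePoint-antitone

      gap : ∀ {i j} → i ℕ.< j → ∃ λ a → j ≡ i ℕ.+ suc a
      gap {i} i<j = let a , eq = ℕₚ.m≤n⇒∃[o]m+o≡n i<j in a , trans (sym eq) (sym (ℕₚ.+-suc i a))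

      -- The first return chosen gives the candidate period `suc a`. For each x a return beyond i +
      -- `suc a` + x commutes with it, which yields the period at x.
      bad⇒periodic : ∀ {C} → (∀ n → ComponentsAtMost w n C) → ¬ ¬ Periodic w
      bad⇒periodic comps = do
        (i , often) ← recurring-class (few-points {δ} bad comps)
        (j , i<j , same) ← often (suc i)
        let a , j≡ = gap i<j
            same-a = subst (Equal i) j≡ same
        return (eventually-periodic⇒periodic rec i (suc a) (s≤s z≤n) λ x →
          -- The far return depends on x and exists only under double negation, which the decidable
          -- equality of letters removes for each x.
          decidable-stable (_ ℕ.≟ _) do
            (j′ , far , same′) ← often (suc (i ℕ.+ (suc a ℕ.+ x)))
            let b , j′≡ = gap (ℕₚ.≤-<-trans (ℕₚ.m≤m+n i (suc a ℕ.+ x)) far)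
            return (commuting-prefixes (λ y → positive (i ℕ.+ y)) (suc a) (suc b)
              (returns-commute i a b same-a (subst (Equal i) j′≡ same′)) x
              (ℕₚ.+-cancelˡ-< i _ _ (subst (i ℕ.+ (suc a ℕ.+ x) ℕ.<_) j′≡ far))))

  -- Normalising the homogeneous coordinates

  res-level : ∀ (x : Zp p) m d → ∃ λ e → res x (d ℕ.+ m) ≡ res x m ℕ.+ e ℕ.* p ^ m
  res-level x m zero    = 0 , sym (ℕₚ.+-identityʳ _)
  res-level x m (suc d) =
    let e , eq = res-level x m d
        e′ , eq′ = compat x (d ℕ.+ m)
    in e ℕ.+ e′ ℕ.* p ^ d , trans eq′ (trans
         (cong₂ (λ s t → s ℕ.+ e′ ℕ.* t) eq (ℕₚ.^-distribˡ-+-* p d m)) (ring (res x m) e (p ^ m) e′ (p ^ d)))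
    where
    ring : ∀ r e q e′ q′ → r ℕ.+ e ℕ.* q ℕ.+ e′ ℕ.* (q′ ℕ.* q) ≡ r ℕ.+ (e ℕ.+ e′ ℕ.* q′) ℕ.* q
    ring = ℕ-solve-∀

  -- x = p^m u
  record Quotient (x : Zp p) (m : ℕ) : Set where
    field
      u        : ℕ → ℕ
      u≡       : ∀ K → res x (K ℕ.+ m) ≡ u K ℕ.* p ^ m
      u-compat : ∀ K → + u (suc K) ≡ + u K [ pw K ]

  divide : ∀ (x : Zp p) m → p ^ m ℕ∣.∣ res x m → Quotient x m
  divide x m (ℕ∣.divides t eq) = record
    { u = λ K → proj₁ (quot K) ; u≡ = λ K → proj₂ (quot K)
    ; u-compat = λ K → let e , eq = compat x (K ℕ.+ m) in
        step K (proj₁ (quot K)) (proj₁ (quot (suc K))) e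
          (trans (sym (proj₂ (quot (suc K)))) (trans eq (cong (ℕ._+ e ℕ.* p ^ (K ℕ.+ m)) (proj₂ (quot K))))) }
    where
    quot : ∀ K → ∃ λ u → res x (K ℕ.+ m) ≡ u ℕ.* p ^ m
    quot K = let e , eq′ = res-level x m K in
      t ℕ.+ e , trans eq′ (trans (cong (ℕ._+ e ℕ.* p ^ m) eq) (sym (ℕₚ.*-distribʳ-+ (p ^ m) t e)))
    step : ∀ K u u′ e → u′ ℕ.* p ^ m ≡ u ℕ.* p ^ m ℕ.+ e ℕ.* p ^ (K ℕ.+ m) → + u′ ≡ + u [ pw K ]
    step K u u′ e eq = mod (divides (+ e) (trans
      (cong (_- + u) (trans (cong +_ u′≡) (trans (pos-+ u _) (cong (_+_ (+ u)) (pos-* e (p ^ K))))))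
      (ring (+ u) (+ e * pw K))))
      where
      ring : ∀ u v → u + v - u ≡ v
      ring = solve-∀
      u′≡ : u′ ≡ u ℕ.+ e ℕ.* p ^ K
      u′≡ = ℕₚ.*-cancelʳ-≡ u′ _ (p ^ m) {{ℕₚ.m^n≢0 p m}} (trans eq (trans
        (cong (u ℕ.* p ^ m ℕ.+_) (trans (cong (e ℕ.*_) (ℕₚ.^-distribˡ-+-* p K m)) (sym (ℕₚ.*-assoc e (p ^ K) (p ^ m)))))
        (sym (ℕₚ.*-distribʳ-+ (p ^ m) u (e ℕ.* p ^ K)))))

  module _ (x1 x2 : Zp p) where

    Vanishes : ℕ → Set
    Vanishes k = (p ^ k ℕ∣.∣ res x1 k) × (p ^ k ℕ∣.∣ res x2 k)

    least-valuation : ∀ k → ¬ Vanishes k → ∃ λ m → Vanishes m × ¬ Vanishes (suc m)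
    least-valuation zero    h = contradiction (ℕ∣.1∣ _ , ℕ∣.1∣ _) h
    least-valuation (suc k) h with (p ^ k ℕ∣.∣? res x1 k) ×-dec (p ^ k ℕ∣.∣? res x2 k)
    ... | yes v = k , v , h
    ... | no ¬v = least-valuation k ¬v

    -- Here x = p^m u, so a factor p of u at any positive precision already shows in x at precision
    -- m + 1.
    divisible : ∀ (x : Zp p) {m} (q : Quotient x m) K → P ∣ + Quotient.u q (suc K) → p ^ suc m ℕ∣.∣ res x (suc m)
    divisible x {m} q K h =
      let e , eq = res-level x (suc m) K
      in ℕ∣.∣m+n∣m⇒∣n (subst (p ^ suc m ℕ∣.∣_) (ℕₚ.+-comm (res x (suc m)) (e ℕ.* p ^ suc m))
           (subst (p ^ suc m ℕ∣.∣_) (trans (sym (u≡ (suc K))) (trans (cong (res x) (sym (ℕₚ.+-suc K m))) eq))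
             (ℕ∣.*-monoˡ-∣ (p ^ m) (∣⇒∣ᵤ h)))) (ℕ∣.n∣m*n e)
      where open Quotient q

    -- The LMad condition in primitive coordinates

    module _ {m} (vanishes : Vanishes m) (¬vanishes : ¬ Vanishes (suc m)) {w : Word} {i j : ℕ} (lmad : LMadε p i j w x1 x2) where
      open Quotient (divide x1 m (proj₁ vanishes)) renaming (u to v₁; u≡ to v₁≡; u-compat to v₁-compat)
      open Quotient (divide x2 m (proj₂ vanishes)) renaming (u to v₂; u≡ to v₂≡; u-compat to v₂-compat)

      v-primitive : ∀ K → ¬ ((P ∣ + v₁ (suc K)) × (P ∣ + v₂ (suc K)))
      v-primitive K (h₁ , h₂) = ¬vanishes
        (divisible x1 (divide x1 m (proj₁ vanishes)) K h₁ , divisible x2 (divide x2 m (proj₂ vanishes)) K h₂)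

      -- An integral matrix of determinant ±1 preserves the minimum m of the two valuations, so l =
      -- m is admissible in `PBadAt` for every n.
      unimodular : ∀ n → ¬ (ValGe x1 x2 (+ m11 (Mpow w n)) (+ m12 (Mpow w n)) (suc m) ×
                            ValGe x1 x2 (+ m21 (Mpow w n)) (+ m22 (Mpow w n)) (suc m))
      unimodular n (h₁ , h₂) =
        let d₁ , d₂ = invert-rows {pw (suc m)} (Mpow w n) (+ res x1 (suc m)) (+ res x2 (suc m)) (Mpow-det w n) (∣ᵤ⇒∣ h₁) (∣ᵤ⇒∣ h₂)
        in ¬vanishes (∣⇒∣ᵤ d₁ , ∣⇒∣ᵤ d₂)

      value : ∀ n K a b → pw K ∣ a * row₁ (Mpow w n) (+ v₁ K) (+ v₂ K) + b * row₂ (Mpow w n) (+ v₁ K) (+ v₂ K) →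
        ValGe x1 x2 (a * + m11 (Mpow w n) + b * + m21 (Mpow w n)) (a * + m12 (Mpow w n) + b * + m22 (Mpow w n)) (K ℕ.+ m)
      value n K a b h = ∣⇒∣ᵤ (subst₂ _∣_ (sym (pw-+ K m))
        (trans (ring a b (+ m11 M) (+ m12 M) (+ m21 M) (+ m22 M) (+ v₁ K) (+ v₂ K) (pw m))
          (cong₂ (λ s t → (a * + m11 M + b * + m21 M) * s + (a * + m12 M + b * + m22 M) * t)
            (trans (sym (pos-* (v₁ K) (p ^ m))) (cong +_ (sym (v₁≡ K))))
            (trans (sym (pos-* (v₂ K) (p ^ m))) (cong +_ (sym (v₂≡ K))))))
        (*-monoˡ-∣ (pw m) h))
        where
        M = Mpow w n
        ring : ∀ a b m11 m12 m21 m22 v₁ v₂ q → (a * (m11 * v₁ + m12 * v₂) + b * (m21 * v₁ + m22 * v₂)) * q ≡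
          (a * m11 + b * m21) * (v₁ * q) + (a * m12 + b * m22) * (v₂ * q)
        ring = solve-∀

      -- `PBadAt` is used with k = K + m and l = m; then p^m cancels. The numerator of ε is at least
      -- 1, which leaves its denominator `suc j` as the constant.
      badly : ∀ n K a b → ¬ (a ≡ 0ℤ × b ≡ 0ℤ) →
        pw K ∣ a * row₁ (Mpow w n) (+ v₁ K) (+ v₂ K) + b * row₂ (Mpow w n) (+ v₁ K) (+ v₂ K) →
        p ^ K ℕ.≤ suc j ℕ.* (∣ a ∣ ℕ.⊔ ∣ b ∣) ^ 2
      badly n K a b nonzero h = ℕₚ.*-cancelʳ-≤ (p ^ K) _ (p ^ m) {{ℕₚ.m^n≢0 p m}} (begin
        p ^ K ℕ.* p ^ m                                 ≡⟨ sym (ℕₚ.^-distribˡ-+-* p K m) ⟩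
        p ^ (K ℕ.+ m)                                   ≤⟨ ℕₚ.m≤n*m (p ^ (K ℕ.+ m)) (suc i) ⟩
        suc i ℕ.* p ^ (K ℕ.+ m)                         ≤⟨ proj₂ (lmad n) a b nonzero (K ℕ.+ m) m (value n K a b h) (unimodular n) ⟩
        suc j ℕ.* (∣ a ∣ ℕ.⊔ ∣ b ∣) ^ 2 ℕ.* p ^ m       ∎)
        where open ℕₚ.≤-Reasoning

      lmad⇒periodic : ∀ {C} → Recurrent w → Positive w → (∀ n → ComponentsAtMost w n C) → ¬ ¬ Periodic w
      lmad⇒periodic rec positive = bad⇒periodic rec (λ K → + v₁ K) (λ K → + v₂ K) v₁-compat v₂-compat v-primitive {suc j} badly positive

theorem4 : (p : ℕ) → Prime p → (N : ℕ) → (w : Word) → InAlphabet N w →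
    ¬ Periodic w → UniformlyRecurrent w →
    (∃ λ C → ∀ (n : ℕ) → ComponentsAtMost w n C) →
    (x1 x2 : Zp p) → NonZeroPt x1 x2 → ¬ LMad p w x1 x2
theorem4 p pp N w alphabet aperiodic ur (C , comps) x1 x2 (k , nonzero) (i , j , lmad) =
  let m , vanishes , ¬vanishes = least-valuation x1 x2 k nonzero
  in lmad⇒periodic x1 x2 vanishes ¬vanishes {w} {i} {j} lmad (recurrent ur) (λ x → proj₁ (alphabet x)) comps aperiodic
  where open Conclusion p pp
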